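{- Let $T=\{1342,1423,2314\}$. Then $$F_T(x)=\frac{1-3x+x^2}{1-x}\,C^3(x).$$
   Context: $S_n(T)$ denotes the set of permutations $\pi$ of $[n]=\{1,\dots,n\}$ (one-line notation) that avoid every pattern $\tau\in T$, i.e. no subsequence of $\pi$ is order-isomorphic to $\tau$. $F_T(x)=\sum_{n\ge 0}|S_n(T)|x^n$, a formal power series, with $|S_0(T)|=1$. $C(x)=\frac{1-\sqrt{1-4x}}{2x}=\sum_{n\ge0}\frac{1}{n+1}\binom{2n}{n}x^n$ is the generating function of the Catalan numbers, and $C^3(x)=(C(x))^3$. -}

module Defs where

open import Data.Fin.Base using (toℕ; cast)
open import Data.Fin.Properties using () renaming (all? to allFin?)
open import Data.Integer.Base as ℤ using (ℤ; 0ℤ; 1ℤ)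
import Data.Integer.Properties as ℤₚ
open import Algebra.Properties.Monoid.Sum ℤₚ.+-0-monoid using (sum⁺-syntax)
open import Data.List.Base using (List; []; _∷_; [_]; _++_; map; concatMap; filter; deduplicate; length; lookup; applyUpTo)
open import Data.List.Properties using (≡-dec)
open import Data.List.Membership.Propositional using (_∈_; find; lose)
open import Data.List.Membership.Propositional.Properties
open import Data.List.Relation.Binary.BagAndSetEquality using (∼bag⇒↭)
open import Data.List.Membership.Propositional.Properties.WithK using (unique∧set⇒bag)
open import Data.List.Relation.Binary.Permutation.Propositional using (_↭_; ↭-refl; ↭-sym; ↭-trans; prep; swap)
open import Data.List.Relation.Binary.Permutation.Propositional.Properties using (↭-empty-inv; ∈-resp-↭; drop-mid; ↭-length)
open import Data.List.Relation.Binary.Sublist.Propositional using (_⊆_; []; _∷_; _∷ʳ_)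
open import Data.List.Relation.Unary.All as All using (All)
open import Data.List.Relation.Unary.Any using (here; there; any?)
open import Data.List.Relation.Unary.Unique.Propositional using (Unique)
open import Data.List.Relation.Unary.Unique.DecPropositional.Properties using (deduplicate-!)
open import Data.Nat.Base as ℕ using (ℕ; zero; suc; _<_; _∸_)
open import Data.Nat.Combinatorics using (nC1≡n; nCk+nC[k+1]≡[n+1]C[k+1]) renaming (_C_ to _choose_)
open import Data.Nat.Divisibility using (_∣_; divides; ∣m+n∣m⇒∣n; m∣m*n)
open import Data.Nat.DivMod using (m*[n/m]≡n)
import Data.Nat.Properties as ℕₚ
open import Data.Nat.Tactic.RingSolver using (solve-∀)
open import Data.Product.Base using (∃-syntax; _×_; _,_)
open import Data.Sum.Base using (inj₁; inj₂)
open import Function.Base using (_∘_)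
open import Function.Bundles using (_⇔_; mk⇔; Equivalence)
open import Function.Construct.Composition using (_⇔-∘_)
open import Function.Construct.Symmetry using (⇔-sym)
open import Level using (0ℓ)
open import Relation.Binary.PropositionalEquality hiding ([_])
open import Relation.Nullary using (Dec; yes; no; ¬_; ¬?)
open import Relation.Nullary.Decidable using (map′; True; toWitness; _×-dec_; _→-dec_)
open import Relation.Unary using (Pred; Decidable)

record Enumeration {A : Set} (P : Pred A 0ℓ) : Set where
  field
    elements   : List A
    unique     : Unique elements
    enumerates : ∀ {x} → x ∈ elements ⇔ P x

  card : ℕ
  card = length elements

card-unique : {A : Set} {P : Pred A 0ℓ} (e e′ : Enumeration P) →
              Enumeration.card e ≡ Enumeration.card e′
card-unique e e′ = ↭-length (∼bag⇒↭ (unique∧set⇒bag E.unique E′.unique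
  (⇔-sym E′.enumerates ⇔-∘ E.enumerates)))
  where
  module E  = Enumeration e
  module E′ = Enumeration e′

-- One-line notation: both permutations and patterns are lists of their
-- values.
Word : Set
Word = List ℕ

record OrderIsomorphic (σ τ : Word) : Set where
  constructor mkOrderIso
  field
    length-≡ : length σ ≡ length τ
    lookup-< : ∀ i j → lookup σ i < lookup σ j ⇔
                       lookup τ (cast length-≡ i) < lookup τ (cast length-≡ j)

_Contains_ : Word → Word → Set
π Contains τ = ∃[ σ ] σ ⊆ π × OrderIsomorphic σ τ

_Avoids_ : Word → Word → Set
π Avoids τ = ¬ (π Contains τ)

-- applyUpTo suc n is the list 1, …, n.
IsPermutationOf[1⋯_] : ℕ → Pred Word 0ℓ
IsPermutationOf[1⋯ n ] π = π ↭ applyUpTo suc n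

S : ℕ → List Word → Pred Word 0ℓ
S n T π = IsPermutationOf[1⋯ n ] π × All (π Avoids_) T

private
  _⇔?_ : {A B : Set} → Dec A → Dec B → Dec (A ⇔ B)
  a? ⇔? b? = map′ (λ (f , g) → mk⇔ f g)
                  (λ e → Equivalence.to e , Equivalence.from e)
                  ((a? →-dec b?) ×-dec (b? →-dec a?))

  orderIsomorphic? : ∀ σ τ → Dec (OrderIsomorphic σ τ)
  orderIsomorphic? σ τ with length σ ℕₚ.≟ length τ
  ... | no  neq = no (neq ∘ OrderIsomorphic.length-≡)
  ... | yes eq = map′ (mkOrderIso eq) OrderIsomorphic.lookup-<
    (allFin? λ i → allFin? λ j →
      (lookup σ i ℕₚ.<? lookup σ j) ⇔?
      (lookup τ (cast eq i) ℕₚ.<? lookup τ (cast eq j)))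

  sublists : Word → List Word
  sublists []       = [ [] ]
  sublists (x ∷ xs) = sublists xs ++ map (x ∷_) (sublists xs)

  sublists-sound : ∀ {σ} π → σ ∈ sublists π → σ ⊆ π
  sublists-sound []       (here refl) = []
  sublists-sound (x ∷ xs) σ∈ with ∈-++⁻ (sublists xs) σ∈
  ... | inj₁ σ∈′ = x ∷ʳ sublists-sound xs σ∈′
  ... | inj₂ σ∈′ with _ , σ′∈ , refl ← ∈-map⁻ (x ∷_) σ∈′ =
    refl ∷ sublists-sound xs σ′∈

  sublists-complete : ∀ {σ π} → σ ⊆ π → σ ∈ sublists π
  sublists-complete []           = here refl
  sublists-complete (x ∷ʳ σ⊆)    = ∈-++⁺ˡ (sublists-complete σ⊆)
  sublists-complete (refl ∷ σ⊆)  = ∈-++⁺ʳ _ (∈-map⁺ _ (sublists-complete σ⊆))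

  contains? : ∀ π τ → Dec (π Contains τ)
  contains? π τ = map′
    (λ any → let σ , σ∈ , iso = find any in σ , sublists-sound π σ∈ , iso)
    (λ (_ , σ⊆ , iso) → lose (sublists-complete σ⊆) iso)
    (any? (λ σ → orderIsomorphic? σ τ) (sublists π))

  insertions : ℕ → Word → List Word
  insertions x []       = [ [ x ] ]
  insertions x (y ∷ ys) = (x ∷ y ∷ ys) ∷ map (y ∷_) (insertions x ys)

  insertions-sound : ∀ {x π} ys → π ∈ insertions x ys → π ↭ x ∷ ys
  insertions-sound []       (here refl) = ↭-refl
  insertions-sound (y ∷ ys) (here refl) = ↭-refl
  insertions-sound (y ∷ ys) (there π∈) with _ , π′∈ , refl ← ∈-map⁻ (y ∷_) π∈ =
    ↭-trans (prep y (insertions-sound ys π′∈)) (swap y _ ↭-refl)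

  insertions-complete : ∀ {x} ys zs → ys ++ [ x ] ++ zs ∈ insertions x (ys ++ zs)
  insertions-complete []       []       = here refl
  insertions-complete []       (z ∷ zs) = here refl
  insertions-complete (y ∷ ys) zs       = there (∈-map⁺ _ (insertions-complete ys zs))

  permutations : Word → List Word
  permutations []       = [ [] ]
  permutations (x ∷ xs) = concatMap (insertions x) (permutations xs)

  permutations-sound : ∀ {π} xs → π ∈ permutations xs → π ↭ xs
  permutations-sound []       (here refl) = ↭-refl
  permutations-sound (x ∷ xs) π∈
    with ρ , ρ∈ , π∈ρ ← find (∈-concatMap⁻ (insertions x) π∈) =
    ↭-trans (insertions-sound ρ π∈ρ) (prep x (permutations-sound xs ρ∈))

  permutations-complete : ∀ {π} xs → π ↭ xs → π ∈ permutations xs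
  permutations-complete []       π↭ with refl ← ↭-empty-inv π↭ = here refl
  permutations-complete (x ∷ xs) π↭
    with ys , zs , refl ← ∈-∃++ (∈-resp-↭ (↭-sym π↭) (here refl)) =
    ∈-concatMap⁺ (insertions x)
      (lose (permutations-complete xs (drop-mid ys [] π↭))
            (insertions-complete ys zs))

S-enumeration : ∀ n T → Enumeration (S n T)
S-enumeration n T = record
  { elements   = deduplicate _≟_ candidates
  ; unique     = deduplicate-! _≟_ candidates
  ; enumerates = mk⇔ sound complete
  }
  where
  _≟_ = ≡-dec ℕₚ._≟_

  avoids? : Decidable (λ π → All (π Avoids_) T)
  avoids? π = All.all? (λ τ → ¬? (contains? π τ)) T

  candidates : List Word
  candidates = filter avoids? (permutations (applyUpTo suc n))

  sound : ∀ {π} → π ∈ deduplicate _≟_ candidates → S n T π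
  sound π∈ =
    let π∈perms , avoids = ∈-filter⁻ avoids? (∈-deduplicate⁻ _≟_ candidates π∈)
    in  permutations-sound _ π∈perms , avoids

  complete : ∀ {π} → S n T π → π ∈ deduplicate _≟_ candidates
  complete (π↭ , avoids) =
    ∈-deduplicate⁺ _≟_ (∈-filter⁺ avoids? (permutations-complete _ π↭) avoids)

∣S∣ : ℕ → List Word → ℕ
∣S∣ n T = Enumeration.card (S-enumeration n T)

-- A formal power series is its coefficient sequence. Integer coefficients
-- suffice: only series with constant coefficient 1 are inverted.
Series : Set
Series = ℕ → ℤ

infixl 6 _+_ _-_
infixl 7 _*_ _/_
infixr 8 _^_

const : ℤ → Series
const a zero    = a
const a (suc _) = 0ℤ

X : Series
X 1 = 1ℤ
X _ = 0ℤ

_+_ : Series → Series → Series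
(f + g) n = f n ℤ.+ g n

_-_ : Series → Series → Series
(f - g) n = f n ℤ.- g n

_*_ : Series → Series → Series
(f * g) n = ∑[ i ≤ n ] (f (toℕ i) ℤ.* g (n ∸ toℕ i))

_^_ : Series → ℕ → Series
f ^ zero  = const 1ℤ
f ^ suc k = f * f ^ k

-- Long division by a series g with constant coefficient 1: the quotient
-- starts with q₀ = f₀, and its tail is the quotient by g of the series
-- (f - q₀ g) / x.
longDivision : Series → Series → Series
longDivision f g zero    = f 0
longDivision f g (suc n) =
  longDivision (λ k → f (suc k) ℤ.- f 0 ℤ.* g (suc k)) g n

-- The implicit argument is solved by evaluation when g is concrete.
_/_ : (f g : Series) {g₀≡1 : True (g 0 ℤₚ.≟ 1ℤ)} → Series
f / g = longDivision f g

/-*-cancel : ∀ f g {g₀≡1 : True (g 0 ℤₚ.≟ 1ℤ)} → (_/_ f g {g₀≡1}) * g ≗ f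
/-*-cancel f g {g₀≡1} = go f
  where
  go : ∀ f → longDivision f g * g ≗ f
  go f zero rewrite toWitness g₀≡1 =
    trans (ℤₚ.+-identityʳ _) (ℤₚ.*-identityʳ (f 0))
  go f (suc n) = trans
    (cong (λ c → f 0 ℤ.* g (suc n) ℤ.+ c) (go (λ k → f (suc k) ℤ.- f 0 ℤ.* g (suc k)) n))
    (cancel (f 0 ℤ.* g (suc n)) (f (suc n)))
    where
    cancel : ∀ a b → a ℤ.+ (b ℤ.- a) ≡ b
    cancel a b = trans (ℤₚ.+-comm a (b ℤ.- a))
      (trans (ℤₚ.+-assoc b (ℤ.- a) a)
        (trans (cong (λ c → b ℤ.+ c) (ℤₚ.+-inverseˡ a)) (ℤₚ.+-identityʳ b)))

F : List Word → Series
F T n = ℤ.+ ∣S∣ n T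

-- ℕ division loses nothing here, see catalan-exact.
catalan : Series
catalan n = ℤ.+ (((2 ℕ.* n) choose n) ℕ./ suc n)

absorption : ∀ m k → suc k ℕ.* (m choose suc k) ℕ.+ k ℕ.* (m choose k) ≡
                     m ℕ.* (m choose k)
absorption zero zero    = refl
absorption zero (suc k) = cong₂ ℕ._+_ (ℕₚ.*-zeroʳ (suc (suc k))) (ℕₚ.*-zeroʳ (suc k))
absorption (suc m) zero = begin
  1 ℕ.* (suc m choose 1) ℕ.+ 0 ≡⟨ ℕₚ.+-identityʳ _ ⟩
  1 ℕ.* (suc m choose 1)       ≡⟨ ℕₚ.*-identityˡ _ ⟩
  suc m choose 1               ≡⟨ nC1≡n (suc m) ⟩
  suc m                        ≡⟨ ℕₚ.*-identityʳ (suc m) ⟨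
  suc m ℕ.* (suc m choose 0)   ∎
  where open ≡-Reasoning
absorption (suc m) (suc k)
  rewrite sym (nCk+nC[k+1]≡[n+1]C[k+1] m k)
        | sym (nCk+nC[k+1]≡[n+1]C[k+1] m (suc k)) = begin
  (2 ℕ.+ k) ℕ.* (b ℕ.+ c) ℕ.+ (1 ℕ.+ k) ℕ.* (a ℕ.+ b)
    ≡⟨ regroup k a b c ⟩
  ((2 ℕ.+ k) ℕ.* c ℕ.+ (1 ℕ.+ k) ℕ.* b) ℕ.+ ((1 ℕ.+ k) ℕ.* b ℕ.+ k ℕ.* a) ℕ.+ (a ℕ.+ b)
    ≡⟨ cong (λ c → c ℕ.+ (a ℕ.+ b)) (cong₂ ℕ._+_ (absorption m (suc k)) (absorption m k)) ⟩
  m ℕ.* b ℕ.+ m ℕ.* a ℕ.+ (a ℕ.+ b)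
    ≡⟨ collect m a b ⟩
  suc m ℕ.* (a ℕ.+ b) ∎
  where
  open ≡-Reasoning
  a = m choose k
  b = m choose suc k
  c = m choose suc (suc k)

  regroup : ∀ k a b c →
    (2 ℕ.+ k) ℕ.* (b ℕ.+ c) ℕ.+ (1 ℕ.+ k) ℕ.* (a ℕ.+ b) ≡
    ((2 ℕ.+ k) ℕ.* c ℕ.+ (1 ℕ.+ k) ℕ.* b) ℕ.+ ((1 ℕ.+ k) ℕ.* b ℕ.+ k ℕ.* a) ℕ.+ (a ℕ.+ b)
  regroup = solve-∀

  collect : ∀ m a b →
    m ℕ.* b ℕ.+ m ℕ.* a ℕ.+ (a ℕ.+ b) ≡ (1 ℕ.+ m) ℕ.* (a ℕ.+ b)
  collect = solve-∀

suc[n]∣2nCn : ∀ n → suc n ∣ (2 ℕ.* n) choose n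
suc[n]∣2nCn n = ∣m+n∣m⇒∣n (divides b eq) (m∣m*n a)
  where
  open ≡-Reasoning
  a = (2 ℕ.* n) choose suc n
  b = (2 ℕ.* n) choose n

  split : ∀ n b → 2 ℕ.* n ℕ.* b ≡ n ℕ.* b ℕ.+ n ℕ.* b
  split = solve-∀

  eq : suc n ℕ.* a ℕ.+ b ≡ b ℕ.* suc n
  eq = begin
    suc n ℕ.* a ℕ.+ b ≡⟨ cong (λ c → c ℕ.+ b) (ℕₚ.+-cancelʳ-≡ (n ℕ.* b) _ _
                           (trans (absorption (2 ℕ.* n) n) (split n b))) ⟩
    n ℕ.* b ℕ.+ b     ≡⟨ ℕₚ.+-comm (n ℕ.* b) b ⟩
    suc n ℕ.* b       ≡⟨ ℕₚ.*-comm (suc n) b ⟩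
    b ℕ.* suc n       ∎

catalan-exact : ∀ n → ℤ.+ suc n ℤ.* catalan n ≡ ℤ.+ ((2 ℕ.* n) choose n)
catalan-exact n = trans (sym (ℤₚ.pos-* (suc n) _))
  (cong ℤ.+_ (m*[n/m]≡n (suc[n]∣2nCn n)))

{-# OPTIONS --safe #-}

-- Build a permutation by inserting its values in decreasing order. A new
-- minimum m may be placed between u and v, where uv avoids the three patterns,
-- exactly when v is layered (avoids 231 and 312) and no ascent xy of u lies below
-- a later letter z of v. In the tree obtained this way only two families of nodes
-- occur. A TwoBlocks node with parameters j and k is a word P A B, where A and
-- B are decreasing of lengths j and 1 + k, A lies below B, and the places for the
-- next minimum are those from the left end of A to the right end of B. A
-- BlockAscent node with parameter j is a word P A Q, where A is decreasing of
-- length j and below Q, Q has an ascent, and the places are those from the left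
-- end of A to the left end of Q, and the right end of Q. The generating functions
-- of the subtrees are
--   C ^ (2 + k) + x C ^ (5 + k) + (j - 1) x C ^ 3 / (1 - x)   and
--   C ^ 3 + (j - 1) x C ^ 3 / (1 - x).
-- A one-letter permutation is the node j = k = 0, so that
-- F_T = 1 / (1 - x) + x² C ^ 5 = (1 - 3 x + x²) / (1 - x) C ^ 3.

module Submission where

open import Defs
open import Data.List.Base using (List; []; _∷_)
open import Relation.Binary.PropositionalEquality using (_≗_)
open import Data.Integer.Base using (+_)

open import Data.Bool.Base using (T)
open import Data.Empty using (⊥)
open import Data.Fin.Base using (cast; toℕ)
open import Data.Fin.Patterns using (0F; 1F; 2F; 3F)
open import Data.Fin.Properties using (toℕ-cast; toℕ-injective) renaming (_≟_ to _≟ᶠ_; all? to allFin?)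
open import Data.Integer.Base as ℤ using (0ℤ; 1ℤ; -1ℤ)
import Data.Integer.Properties as ℤₚ
import Data.Integer.Tactic.RingSolver as ℤ-Solver
open import Data.List.Base using ([_]; _++_; length; lookup; applyUpTo; filter)
open import Data.List.Membership.Propositional using (_∈_)
open import Data.List.Membership.Propositional.Properties using (∈-++⁺ˡ; ∈-++⁺ʳ; ∈-++⁻; ∈-∃++)
open import Data.List.Properties
  using (++-assoc; ++-identityʳ; ++-cancelˡ; ∷-injective; ∷-injectiveˡ; length-++; applyUpTo-∷ʳ;
         filter-all; filter-none; filter-reject; filter-++)
open import Data.List.Relation.Binary.Permutation.Propositional
  using (_↭_; ↭-refl; ↭-sym; ↭-trans; ↭-reflexive)
open import Data.List.Relation.Binary.Permutation.Propositional.Properties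
  using (∈-resp-↭; All-resp-↭; filter-↭; shift; drop-∷; ++⁺ˡ)
open import Data.List.Relation.Binary.Sublist.Propositional
  using (_⊆_; []; _∷_; _∷ʳ_; ⊆-refl; ⊆-trans; ⊆-reflexive; from∈; to∈; minimum)
  renaming (lookup to lookup-⊆)
import Data.List.Relation.Binary.Sublist.Propositional.Properties as ⊆
open import Data.List.Relation.Unary.All as All using (All; []; _∷_)
import Data.List.Relation.Unary.All.Properties as All
open import Data.List.Relation.Unary.AllPairs using ([]; _∷_)
open import Data.List.Relation.Unary.Any using (here; there)
import Data.List.Relation.Unary.Unique.Propositional.Properties as Unique
open import Data.Nat.Base as ℕ using (ℕ; zero; suc; _<_; _<ᵇ_)
open import Data.Nat.Combinatorics using (nCk+nC[k+1]≡[n+1]C[k+1]; nCk≡nC[n∸k]) renaming (_C_ to _choose_)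
import Data.Nat.Properties as ℕₚ
import Data.Nat.Tactic.RingSolver as ℕ-Solver
open import Data.Product.Base using (∃₂; ∃-syntax; _×_; _,_; proj₁; proj₂)
open import Data.Sum.Base using (_⊎_; inj₁; inj₂)
open import Function.Base using (_∘_)
open import Function.Bundles using (_⇔_; mk⇔; Equivalence)
open import Level using (0ℓ)
open import Relation.Binary.Definitions using (tri<; tri≈; tri>)
open import Relation.Binary.PropositionalEquality
  using (_≡_; refl; sym; trans; cong; cong₂; subst; subst₂; module ≡-Reasoning)
open import Relation.Nullary using (¬_; yes; no; contradiction)
open import Relation.Nullary.Decidable using (True; toWitness; _→-dec_)
open import Relation.Unary using (Pred; Decidable)

-- Ballot numbers and generating functions

-- [xⁿ] C(x)ᵏ, computed from Cᵏ⁺¹ = Cᵏ + x Cᵏ⁺².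
ballot : ℕ → ℕ → ℕ
ballot k       zero    = 1
ballot zero    (suc n) = 0
ballot (suc k) (suc n) = ballot k (suc n) ℕ.+ ballot (suc (suc k)) n

ballotSeries : ℕ → Series
ballotSeries k n = + ballot k n

-- `(f * g) (suc n)` reduces to `f 0 ℤ.* g (suc n)` plus `((f ∘ suc) * g) n`, so products are
-- handled by induction on the index with the left factor shifted. The next lemmas use the same
-- recursion.
*-cong : ∀ {f f′ g g′} → f ≗ f′ → g ≗ g′ → f * g ≗ f′ * g′
*-cong f≗ g≗ zero    = cong (ℤ._+ 0ℤ) (cong₂ ℤ._*_ (f≗ 0) (g≗ 0))
*-cong f≗ g≗ (suc n) =
  cong₂ ℤ._+_ (cong₂ ℤ._*_ (f≗ 0) (g≗ (suc n))) (*-cong (f≗ ∘ suc) g≗ n)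

*-distribʳ-+ : ∀ f g h → (f + g) * h ≗ f * h + g * h
*-distribʳ-+ f g h zero    = eq (f 0) (g 0) (h 0)
  where
  eq : ∀ a b c → (a ℤ.+ b) ℤ.* c ℤ.+ 0ℤ ≡ (a ℤ.* c ℤ.+ 0ℤ) ℤ.+ (b ℤ.* c ℤ.+ 0ℤ)
  eq = ℤ-Solver.solve-∀
*-distribʳ-+ f g h (suc n) = trans
  (cong (λ r → (f 0 ℤ.+ g 0) ℤ.* h (suc n) ℤ.+ r) (*-distribʳ-+ (f ∘ suc) (g ∘ suc) h n))
  (eq (f 0) (g 0) (h (suc n)) (((f ∘ suc) * h) n) (((g ∘ suc) * h) n))
  where
  eq : ∀ a b c r s → (a ℤ.+ b) ℤ.* c ℤ.+ (r ℤ.+ s) ≡ (a ℤ.* c ℤ.+ r) ℤ.+ (b ℤ.* c ℤ.+ s)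
  eq = ℤ-Solver.solve-∀

*-zeroˡ : ∀ g → (λ _ → 0ℤ) * g ≗ (λ _ → 0ℤ)
*-zeroˡ g zero    = refl
*-zeroˡ g (suc n) = trans (ℤₚ.+-identityˡ _) (*-zeroˡ g n)

-- The shifted series C ^ (1 + j) is the shifted C ^ j plus C ^ (2 + j), so distributivity lowers
-- either the exponent at the same index or the index itself.
*-ballotSeries : ∀ j k → ballotSeries j * ballotSeries k ≗ ballotSeries (j ℕ.+ k)
*-ballotSeries j       k zero    = refl
*-ballotSeries zero    k (suc n) = trans
  (cong₂ ℤ._+_ (ℤₚ.*-identityˡ (+ ballot k (suc n))) (*-zeroˡ (ballotSeries k) n))
  (ℤₚ.+-identityʳ _)
*-ballotSeries (suc j) k (suc n) = begin
  1ℤ ℤ.* b ℤ.+ ((ballotSeries (suc j) ∘ suc) * ballotSeries k) n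
    ≡⟨ cong (λ z → 1ℤ ℤ.* b ℤ.+ z)
         (*-distribʳ-+ (ballotSeries j ∘ suc) (ballotSeries (suc (suc j))) (ballotSeries k) n) ⟩
  1ℤ ℤ.* b ℤ.+ (((ballotSeries j ∘ suc) * ballotSeries k) n ℤ.+
                (ballotSeries (suc (suc j)) * ballotSeries k) n)
    ≡⟨ ℤₚ.+-assoc (1ℤ ℤ.* b) _ _ ⟨
  (ballotSeries j * ballotSeries k) (suc n) ℤ.+ (ballotSeries (suc (suc j)) * ballotSeries k) n
    ≡⟨ cong₂ ℤ._+_ (*-ballotSeries j k (suc n)) (*-ballotSeries (suc (suc j)) k n) ⟩
  + ballot (j ℕ.+ k) (suc n) ℤ.+ + ballot (suc (suc (j ℕ.+ k))) n ∎
  where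
  open ≡-Reasoning
  b = + ballot k (suc n)

-- The reflection principle gives a difference of neighbouring binomials, written here as a sum to
-- stay in the natural numbers. Pascal's rule carries the recursion of `ballot`.
ballot-choose : ∀ k n {m} → m ≡ suc (k ℕ.+ 2 ℕ.* n) →
                ballot k (suc n) ℕ.+ (m choose n) ≡ m choose suc n
ballot-choose zero n {m} refl = trans (nCk≡nC[n∸k] n≤m) (cong (m choose_) m∸n≡1+n)
  where
  m≡n+[1+n] : m ≡ n ℕ.+ suc n
  m≡n+[1+n] = trans (cong (λ p → suc (n ℕ.+ p)) (ℕₚ.+-identityʳ n)) (sym (ℕₚ.+-suc n n))

  n≤m : n ℕ.≤ m
  n≤m = subst (n ℕ.≤_) (sym m≡n+[1+n]) (ℕₚ.m≤m+n n (suc n))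

  m∸n≡1+n : m ℕ.∸ n ≡ suc n
  m∸n≡1+n = trans (cong (ℕ._∸ n) m≡n+[1+n]) (ℕₚ.m+n∸m≡n n (suc n))
ballot-choose (suc k) n {suc m} refl = begin
  ballot k (suc n) ℕ.+ ballot (suc (suc k)) n ℕ.+ (suc m choose n)
    ≡⟨ ℕₚ.+-assoc (ballot k (suc n)) _ _ ⟩
  ballot k (suc n) ℕ.+ (ballot (suc (suc k)) n ℕ.+ (suc m choose n))
    ≡⟨ cong (ballot k (suc n) ℕ.+_) (lower n refl) ⟩
  ballot k (suc n) ℕ.+ ((m choose n) ℕ.+ (m choose n))
    ≡⟨ ℕₚ.+-assoc (ballot k (suc n)) _ _ ⟨
  ballot k (suc n) ℕ.+ (m choose n) ℕ.+ (m choose n)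
    ≡⟨ cong (ℕ._+ (m choose n)) (ballot-choose k n refl) ⟩
  (m choose suc n) ℕ.+ (m choose n)
    ≡⟨ ℕₚ.+-comm (m choose suc n) _ ⟩
  (m choose n) ℕ.+ (m choose suc n)
    ≡⟨ nCk+nC[k+1]≡[n+1]C[k+1] m n ⟩
  suc m choose suc n ∎
  where
  open ≡-Reasoning

  m≡ : ∀ k n → suc (k ℕ.+ 2 ℕ.* suc n) ≡ suc (suc (suc k) ℕ.+ 2 ℕ.* n)
  m≡ = ℕ-Solver.solve-∀

  -- The index 0 is split off because `ballot-choose` speaks of an index `suc n`.
  lower : ∀ n → m ≡ suc (k ℕ.+ 2 ℕ.* n) →
          ballot (suc (suc k)) n ℕ.+ (suc m choose n) ≡ (m choose n) ℕ.+ (m choose n)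
  lower zero    _  = refl
  lower (suc n) eq = begin
    b ℕ.+ (suc m choose suc n)
      ≡⟨ cong (b ℕ.+_) (nCk+nC[k+1]≡[n+1]C[k+1] m n) ⟨
    b ℕ.+ ((m choose n) ℕ.+ (m choose suc n))
      ≡⟨ ℕₚ.+-assoc b _ _ ⟨
    b ℕ.+ (m choose n) ℕ.+ (m choose suc n)
      ≡⟨ cong (ℕ._+ (m choose suc n)) (ballot-choose (suc (suc k)) n (trans eq (m≡ k n))) ⟩
    (m choose suc n) ℕ.+ (m choose suc n) ∎
    where b = ballot (suc (suc k)) (suc n)

-- `ballot-choose` at k = 1 gives b = d - c and `absorption` gives (n + 1) d = (n + 2) c, whence (n
-- + 2) b = d.
ballot-absorption : ∀ n → suc n ℕ.* ballot 1 n ≡ (2 ℕ.* n) choose n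
ballot-absorption zero    = refl
ballot-absorption (suc n) = ℕₚ.+-cancelʳ-≡ ((2 ℕ.+ n) ℕ.* c) _ _ (begin
  (2 ℕ.+ n) ℕ.* b ℕ.+ (2 ℕ.+ n) ℕ.* c ≡⟨ ℕₚ.*-distribˡ-+ (2 ℕ.+ n) b c ⟨
  (2 ℕ.+ n) ℕ.* (b ℕ.+ c)             ≡⟨ cong ((2 ℕ.+ n) ℕ.*_) b+c≡d ⟩
  (2 ℕ.+ n) ℕ.* d                     ≡⟨⟩
  d ℕ.+ (1 ℕ.+ n) ℕ.* d               ≡⟨ cong (d ℕ.+_) [1+n]d≡[2+n]c ⟩
  d ℕ.+ (2 ℕ.+ n) ℕ.* c               ∎)
  where
  open ≡-Reasoning
  b = ballot 1 (suc n)
  c = (2 ℕ.* suc n) choose n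
  d = (2 ℕ.* suc n) choose suc n

  m≡ : ∀ n → 2 ℕ.* suc n ≡ suc (1 ℕ.+ 2 ℕ.* n)
  m≡ = ℕ-Solver.solve-∀

  b+c≡d : b ℕ.+ c ≡ d
  b+c≡d = ballot-choose 1 n (m≡ n)

  split : ∀ n c → 2 ℕ.* suc n ℕ.* c ≡ (2 ℕ.+ n) ℕ.* c ℕ.+ n ℕ.* c
  split = ℕ-Solver.solve-∀

  [1+n]d≡[2+n]c : (1 ℕ.+ n) ℕ.* d ≡ (2 ℕ.+ n) ℕ.* c
  [1+n]d≡[2+n]c = ℕₚ.+-cancelʳ-≡ (n ℕ.* c) _ _ (trans (absorption (2 ℕ.* suc n) n) (split n c))

catalan≗ballotSeries : catalan ≗ ballotSeries 1
catalan≗ballotSeries n = ℤₚ.*-cancelˡ-≡ (+ suc n) _ _ (begin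
  + suc n ℤ.* catalan n        ≡⟨ catalan-exact n ⟩
  + ((2 ℕ.* n) choose n)       ≡⟨ cong +_ (ballot-absorption n) ⟨
  + (suc n ℕ.* ballot 1 n)     ≡⟨ ℤₚ.pos-* (suc n) _ ⟩
  + suc n ℤ.* ballotSeries 1 n ∎)
  where open ≡-Reasoning

catalan^3≗ballotSeries : catalan ^ 3 ≗ ballotSeries 3
catalan^3≗ballotSeries n =
  trans (*-cong c (*-cong c (*-cong c const≗)) n)
  (trans (*-cong b₁ (*-cong b₁ (*-ballotSeries 1 0)) n)
  (trans (*-cong b₁ (*-ballotSeries 1 1) n) (*-ballotSeries 1 2 n)))
  where
  c = catalan≗ballotSeries
  b₁ : ballotSeries 1 ≗ ballotSeries 1
  b₁ _ = refl
  const≗ : const 1ℤ ≗ ballotSeries 0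
  const≗ zero    = refl
  const≗ (suc _) = refl

-- The coefficients of x C(x)³ / (1 - x).
ballot3-sum : ℕ → ℕ
ballot3-sum zero    = 0
ballot3-sum (suc n) = ballot 3 n ℕ.+ ballot3-sum n

-- The rational factor and its product with C³

longDivision-cong : ∀ {f f′} g → f ≗ f′ → longDivision f g ≗ longDivision f′ g
longDivision-cong g f≗ zero    = f≗ 0
longDivision-cong g f≗ (suc n) = longDivision-cong g
  (λ k → cong₂ (λ a b → a ℤ.- b ℤ.* g (suc k)) (f≗ (suc k)) (f≗ 0)) n

numerator : Series
numerator = const (+ 1) - const (+ 3) * X + X ^ 2

*-identityˡ : ∀ g → const 1ℤ * g ≗ g
*-identityˡ g zero    = trans (ℤₚ.+-identityʳ _) (ℤₚ.*-identityˡ (g 0))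
*-identityˡ g (suc n) = trans
  (cong₂ ℤ._+_ (ℤₚ.*-identityˡ (g (suc n))) (*-zeroˡ g n)) (ℤₚ.+-identityʳ _)

X*-suc : ∀ g n → (X * g) (suc n) ≡ g n
X*-suc g n = trans (ℤₚ.+-identityˡ _)
  (trans (*-cong {g = g} X∘suc≗1 (λ _ → refl) n) (*-identityˡ g n))
  where
  X∘suc≗1 : X ∘ suc ≗ const 1ℤ
  X∘suc≗1 zero    = refl
  X∘suc≗1 (suc _) = refl

numerator-vanishes : ∀ n → numerator (3 ℕ.+ n) ≡ 0ℤ
numerator-vanishes n = cong₂ (λ a b → 0ℤ ℤ.- a ℤ.+ b)
  (trans (ℤₚ.+-identityˡ _) (*-zeroˡ X (2 ℕ.+ n)))
  (trans (X*-suc (X ^ 1) (2 ℕ.+ n)) (X*-suc (X ^ 0) (1 ℕ.+ n)))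

-- The expansion 1 - 2 x - x² - x³ - ....
quotient : Series
quotient 0 = 1ℤ
quotient 1 = ℤ.- + 2
quotient _ = -1ℤ

numerator/[1-X] : numerator / (const (+ 1) - X) ≗ quotient
numerator/[1-X] 0             = refl
numerator/[1-X] 1             = refl
numerator/[1-X] (suc (suc n)) = trans
  (longDivision-cong 1-X remainder n) (constant n)
  where
  1-X = const (+ 1) - X

  -- Two steps of the long division, with quotient terms 1 and -2, leave the constant remainder -1.
  remainder : (λ k → numerator (2 ℕ.+ k) ℤ.- numerator 0 ℤ.* 1-X (2 ℕ.+ k)
                       ℤ.- (ℤ.- + 2) ℤ.* 1-X (suc k)) ≗ const -1ℤ
  remainder zero    = refl
  remainder (suc k) = cong (λ a → a ℤ.- 0ℤ ℤ.- 0ℤ) (numerator-vanishes k)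

  -- Dividing -1 by 1 - x yields the term -1 and leaves -1 again.
  constant : longDivision (const -1ℤ) 1-X ≗ (λ _ → -1ℤ)
  constant zero    = refl
  constant (suc n) = trans (longDivision-cong 1-X step n) (constant n)
    where
    step : (λ k → const -1ℤ (suc k) ℤ.- -1ℤ ℤ.* 1-X (suc k)) ≗ const -1ℤ
    step zero    = refl
    step (suc _) = refl

-- `ballot 1 (suc n)` reduces to `ballot 2 n`, so successive coefficients of C² differ by one of C³.
-- As series, C² = 1 / (1 - x) + x C³ / (1 - x).
ballot2≡1+ballot3-sum : ∀ n → ballot 2 n ≡ suc (ballot3-sum n)
ballot2≡1+ballot3-sum zero    = refl
ballot2≡1+ballot3-sum (suc n) = trans
  (cong (ℕ._+ ballot 3 n) (ballot2≡1+ballot3-sum n))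
  (cong suc (ℕₚ.+-comm (ballot3-sum n) (ballot 3 n)))

-- The coefficients of 1 / (1 - x) + x² C(x)⁵.
avoiderCount : ℕ → ℕ
avoiderCount (suc (suc n)) = suc (ballot 5 n)
avoiderCount _             = 1

-- From index 2 on, the tail of `quotient` contributes minus a partial sum of C³. Unfolding
-- `ballot 3 (2 + n)` and using `ballot2≡1+ballot3-sum` cancels everything but 1 + [xⁿ] C⁵.
quotient*ballotSeries : quotient * ballotSeries 3 ≗ (λ n → + avoiderCount n)
quotient*ballotSeries 0             = refl
quotient*ballotSeries 1             = refl
quotient*ballotSeries (suc (suc n)) = begin
  1ℤ ℤ.* + ballot 3 (2 ℕ.+ n) ℤ.+ (ℤ.- + 2 ℤ.* + b₃ ℤ.+ ((λ _ → -1ℤ) * ballotSeries 3) n)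
    ≡⟨ cong₂ (λ a r → 1ℤ ℤ.* + a ℤ.+ (ℤ.- + 2 ℤ.* + b₃ ℤ.+ r)) ballot3≡ (-1* n) ⟩
  1ℤ ℤ.* + (suc b₅ ℕ.+ (b₃ ℕ.+ b₃ ℕ.+ s)) ℤ.+ (ℤ.- + 2 ℤ.* + b₃ ℤ.+ ℤ.- + s)
    ≡⟨ cancel (+ suc b₅) (+ b₃) (+ s) ⟩
  + suc b₅ ∎
  where
  open ≡-Reasoning
  b₃ = ballot 3 (suc n)
  b₅ = ballot 5 n
  s  = ballot3-sum (suc n)

  regroup : ∀ a b s → suc s ℕ.+ b ℕ.+ (b ℕ.+ a) ≡ suc a ℕ.+ (b ℕ.+ b ℕ.+ s)
  regroup = ℕ-Solver.solve-∀

  ballot3≡ : ballot 3 (2 ℕ.+ n) ≡ suc b₅ ℕ.+ (b₃ ℕ.+ b₃ ℕ.+ s)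
  ballot3≡ = trans
    (cong (λ a → a ℕ.+ b₃ ℕ.+ (b₃ ℕ.+ b₅)) (ballot2≡1+ballot3-sum (suc n)))
    (regroup b₅ b₃ s)

  cancel : ∀ a b s → 1ℤ ℤ.* (a ℤ.+ (b ℤ.+ b ℤ.+ s)) ℤ.+ (ℤ.- + 2 ℤ.* b ℤ.+ ℤ.- s) ≡ a
  cancel = ℤ-Solver.solve-∀

  negate : ∀ a s → -1ℤ ℤ.* a ℤ.+ ℤ.- s ≡ ℤ.- (a ℤ.+ s)
  negate = ℤ-Solver.solve-∀

  -1* : ∀ n → ((λ _ → -1ℤ) * ballotSeries 3) n ≡ ℤ.- + ballot3-sum (suc n)
  -1* zero    = refl
  -1* (suc n) = trans
    (cong (λ r → -1ℤ ℤ.* + ballot 3 (suc n) ℤ.+ r) (-1* n))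
    (negate (+ ballot 3 (suc n)) (+ ballot3-sum (suc n)))

-- Recurrences of the generating tree and their solution

sumBelow : (ℕ → ℕ) → ℕ → ℕ
sumBelow f zero    = 0
sumBelow f (suc n) = f n ℕ.+ sumBelow f n

mutual
  -- Here `d` insertions remain. The summands are the children by place from left to right: before a
  -- letter of A, between A and B, before a letter of B other than its first, and at the right end.
  twoBlockCount : (d j k : ℕ) → ℕ
  twoBlockCount zero    j k = 1
  twoBlockCount (suc d) j k =
    j ℕ.* ascentCount d 1 ℕ.+ (twoBlockCount d (suc j) k ℕ.+
      (sumBelow (twoBlockCount d 1) k ℕ.+ twoBlockCount d 0 (suc k)))

  -- Likewise the places before a letter of A, between A and Q, and at the right end.
  ascentCount : (d j : ℕ) → ℕ
  ascentCount zero    j = 1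
  ascentCount (suc d) j =
    j ℕ.* ascentCount d 1 ℕ.+ (ascentCount d (suc j) ℕ.+ twoBlockCount d 0 0)

-- The coefficients of Cᵏ + x Cᵏ⁺³.
ballotPair : ℕ → ℕ → ℕ
ballotPair k zero    = ballot k 0
ballotPair k (suc n) = ballot k (suc n) ℕ.+ ballot (3 ℕ.+ k) n

-- This is Cᵏ⁺¹ = Cᵏ + x Cᵏ⁺² multiplied by 1 + x C³.
ballotPair-step : ∀ k n → ballotPair (suc k) (suc n) ≡ ballotPair k (suc n) ℕ.+ ballotPair (2 ℕ.+ k) n
ballotPair-step k zero    = refl
ballotPair-step k (suc n) =
  eq (ballot k (2 ℕ.+ n)) (ballot (2 ℕ.+ k) (suc n)) (ballot (3 ℕ.+ k) (suc n)) (ballot (5 ℕ.+ k) n)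
  where
  eq : ∀ a b c d → a ℕ.+ b ℕ.+ (c ℕ.+ d) ≡ a ℕ.+ c ℕ.+ (b ℕ.+ d)
  eq = ℕ-Solver.solve-∀

-- Each further summand raises the index on the right by one, through `ballotPair-step`. Up to
-- partial sums of C³, this is the total over the children of a TwoBlocks node with j = 0.
ballotPair-sum : ∀ k n →
  ballot 3 n ℕ.+ (sumBelow (λ i → ballotPair (2 ℕ.+ i) n) (2 ℕ.+ k)) ≡ ballotPair (2 ℕ.+ k) (suc n)
ballotPair-sum zero zero = refl
ballotPair-sum zero (suc n) = eq (ballot 2 (suc n)) (ballot 3 (suc n)) (ballot 5 n) (ballot 6 n)
  where
  eq : ∀ a b c d → b ℕ.+ (b ℕ.+ d ℕ.+ (a ℕ.+ c ℕ.+ 0)) ≡ a ℕ.+ b ℕ.+ (b ℕ.+ c ℕ.+ d)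
  eq = ℕ-Solver.solve-∀
ballotPair-sum (suc k) n = begin
  ballot 3 n ℕ.+ (ballotPair (4 ℕ.+ k) n ℕ.+ s)  ≡⟨ swap (ballot 3 n) _ s ⟩
  ballot 3 n ℕ.+ s ℕ.+ ballotPair (4 ℕ.+ k) n    ≡⟨ cong (ℕ._+ ballotPair (4 ℕ.+ k) n) (ballotPair-sum k n) ⟩
  ballotPair (2 ℕ.+ k) (suc n) ℕ.+ ballotPair (4 ℕ.+ k) n ≡⟨ ballotPair-step (2 ℕ.+ k) n ⟨
  ballotPair (3 ℕ.+ k) (suc n) ∎
  where
  open ≡-Reasoning
  s = sumBelow (λ i → ballotPair (2 ℕ.+ i) n) (2 ℕ.+ k)
  swap : ∀ a b c → a ℕ.+ (b ℕ.+ c) ≡ a ℕ.+ c ℕ.+ b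
  swap = ℕ-Solver.solve-∀

sumBelow-cong : ∀ {f g} → f ≗ g → sumBelow f ≗ sumBelow g
sumBelow-cong f≗g zero    = refl
sumBelow-cong f≗g (suc n) = cong₂ ℕ._+_ (f≗g n) (sumBelow-cong f≗g n)

mutual
  -- The factor j - 1 of x C³ / (1 - x) is negative at j = 0, so one partial sum is moved to the
  -- left. The induction on `d` runs jointly with `ascentCount-closed`; at j = 1 the partial sums
  -- cancel, which settles the children whose A has one letter.
  twoBlockCount-closed : ∀ d j k →
    twoBlockCount d j k ℕ.+ ballot3-sum d ≡ ballotPair (2 ℕ.+ k) d ℕ.+ j ℕ.* ballot3-sum d
  twoBlockCount-closed zero j k = sym (cong suc (ℕₚ.*-zeroʳ j))
  twoBlockCount-closed (suc d) j k = begin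
    j ℕ.* ascentCount d 1 ℕ.+ (twoBlockCount d (suc j) k ℕ.+ (sumBelow (twoBlockCount d 1) k ℕ.+ t₀))
      ℕ.+ (b ℕ.+ s)
      ≡⟨ cong₂ (λ e u → j ℕ.* e ℕ.+ (t₁ ℕ.+ (u ℕ.+ t₀)) ℕ.+ (b ℕ.+ s))
           (ascentCount-one d) (sumBelow-cong (twoBlockCount-one d) k) ⟩
    j ℕ.* b ℕ.+ (t₁ ℕ.+ (u ℕ.+ t₀)) ℕ.+ (b ℕ.+ s)
      ≡⟨ regroup₁ (j ℕ.* b) t₁ u t₀ b s ⟩
    j ℕ.* b ℕ.+ (t₁ ℕ.+ s) ℕ.+ t₀ ℕ.+ (b ℕ.+ u)
      ≡⟨ cong (λ v → j ℕ.* b ℕ.+ v ℕ.+ t₀ ℕ.+ (b ℕ.+ u)) (twoBlockCount-closed d (suc j) k) ⟩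
    j ℕ.* b ℕ.+ (p ℕ.+ (s ℕ.+ j ℕ.* s)) ℕ.+ t₀ ℕ.+ (b ℕ.+ u)
      ≡⟨ regroup₂ j b p s t₀ u ⟩
    (t₀ ℕ.+ s) ℕ.+ (b ℕ.+ (p ℕ.+ u)) ℕ.+ j ℕ.* (b ℕ.+ s)
      ≡⟨ cong (λ v → v ℕ.+ (b ℕ.+ (p ℕ.+ u)) ℕ.+ j ℕ.* (b ℕ.+ s)) (twoBlockCount-closed d 0 (suc k)) ⟩
    (q ℕ.+ 0) ℕ.+ (b ℕ.+ (p ℕ.+ u)) ℕ.+ j ℕ.* (b ℕ.+ s)
      -- `q`, `p` and `u` are the summands of index `1 + k`, of index `k` and below `k` in
      -- `ballotPair-sum`.
      ≡⟨ cong (ℕ._+ j ℕ.* (b ℕ.+ s)) (trans (regroup₃ q b p u) (ballotPair-sum k d)) ⟩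
    ballotPair (2 ℕ.+ k) (suc d) ℕ.+ j ℕ.* (b ℕ.+ s) ∎
    where
    open ≡-Reasoning
    b  = ballot 3 d
    s  = ballot3-sum d
    p  = ballotPair (2 ℕ.+ k) d
    q  = ballotPair (3 ℕ.+ k) d
    t₀ = twoBlockCount d 0 (suc k)
    t₁ = twoBlockCount d (suc j) k
    u  = sumBelow (λ i → ballotPair (2 ℕ.+ i) d) k

    regroup₁ : ∀ e t₁ u t₀ b s →
      e ℕ.+ (t₁ ℕ.+ (u ℕ.+ t₀)) ℕ.+ (b ℕ.+ s) ≡ e ℕ.+ (t₁ ℕ.+ s) ℕ.+ t₀ ℕ.+ (b ℕ.+ u)
    regroup₁ = ℕ-Solver.solve-∀

    regroup₂ : ∀ j b p s t₀ u →
      j ℕ.* b ℕ.+ (p ℕ.+ (s ℕ.+ j ℕ.* s)) ℕ.+ t₀ ℕ.+ (b ℕ.+ u) ≡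
      (t₀ ℕ.+ s) ℕ.+ (b ℕ.+ (p ℕ.+ u)) ℕ.+ j ℕ.* (b ℕ.+ s)
    regroup₂ = ℕ-Solver.solve-∀

    regroup₃ : ∀ q b p u → (q ℕ.+ 0) ℕ.+ (b ℕ.+ (p ℕ.+ u)) ≡ b ℕ.+ (q ℕ.+ (p ℕ.+ u))
    regroup₃ = ℕ-Solver.solve-∀

  ascentCount-closed : ∀ d j →
    ascentCount d j ℕ.+ ballot3-sum d ≡ ballot 3 d ℕ.+ j ℕ.* ballot3-sum d
  ascentCount-closed zero j = sym (cong suc (ℕₚ.*-zeroʳ j))
  ascentCount-closed (suc d) j = begin
    j ℕ.* ascentCount d 1 ℕ.+ (e ℕ.+ t) ℕ.+ (b ℕ.+ s)
      ≡⟨ cong (λ a → j ℕ.* a ℕ.+ (e ℕ.+ t) ℕ.+ (b ℕ.+ s)) (ascentCount-one d) ⟩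
    j ℕ.* b ℕ.+ (e ℕ.+ t) ℕ.+ (b ℕ.+ s)
      ≡⟨ regroup₁ (j ℕ.* b) e t b s ⟩
    j ℕ.* b ℕ.+ (e ℕ.+ s) ℕ.+ (t ℕ.+ b)
      ≡⟨ cong (λ a → j ℕ.* b ℕ.+ a ℕ.+ (t ℕ.+ b)) (ascentCount-closed d (suc j)) ⟩
    j ℕ.* b ℕ.+ (b ℕ.+ (s ℕ.+ j ℕ.* s)) ℕ.+ (t ℕ.+ b)
      ≡⟨ regroup₂ j b s t ⟩
    (t ℕ.+ s) ℕ.+ (b ℕ.+ b) ℕ.+ j ℕ.* (b ℕ.+ s)
      ≡⟨ cong (λ a → a ℕ.+ (b ℕ.+ b) ℕ.+ j ℕ.* (b ℕ.+ s)) (twoBlockCount-closed d 0 0) ⟩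
    (ballotPair 2 d ℕ.+ 0) ℕ.+ (b ℕ.+ b) ℕ.+ j ℕ.* (b ℕ.+ s)
      ≡⟨ cong (ℕ._+ j ℕ.* (b ℕ.+ s)) (last d) ⟩
    ballot 3 (suc d) ℕ.+ j ℕ.* (b ℕ.+ s) ∎
    where
    open ≡-Reasoning
    b = ballot 3 d
    s = ballot3-sum d
    e = ascentCount d (suc j)
    t = twoBlockCount d 0 0

    regroup₁ : ∀ f e t b s → f ℕ.+ (e ℕ.+ t) ℕ.+ (b ℕ.+ s) ≡ f ℕ.+ (e ℕ.+ s) ℕ.+ (t ℕ.+ b)
    regroup₁ = ℕ-Solver.solve-∀

    regroup₂ : ∀ j b s t →
      j ℕ.* b ℕ.+ (b ℕ.+ (s ℕ.+ j ℕ.* s)) ℕ.+ (t ℕ.+ b) ≡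
      (t ℕ.+ s) ℕ.+ (b ℕ.+ b) ℕ.+ j ℕ.* (b ℕ.+ s)
    regroup₂ = ℕ-Solver.solve-∀

    regroup₃ : ∀ a b c → a ℕ.+ c ℕ.+ 0 ℕ.+ (b ℕ.+ b) ≡ a ℕ.+ b ℕ.+ (b ℕ.+ c)
    regroup₃ = ℕ-Solver.solve-∀

    -- The identity C³ = 1 + x (C² + x C⁵ + 2 C³), by unfolding `ballot`.
    last : ∀ d → (ballotPair 2 d ℕ.+ 0) ℕ.+ (ballot 3 d ℕ.+ ballot 3 d) ≡ ballot 3 (suc d)
    last zero    = refl
    last (suc d) = regroup₃ (ballot 2 (suc d)) (ballot 3 (suc d)) (ballot 5 d)

  ascentCount-one : ∀ d → ascentCount d 1 ≡ ballot 3 d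
  ascentCount-one d = ℕₚ.+-cancelʳ-≡ (ballot3-sum d) _ _
    (trans (ascentCount-closed d 1) (cong (ballot 3 d ℕ.+_) (ℕₚ.+-identityʳ _)))

  twoBlockCount-one : ∀ d k → twoBlockCount d 1 k ≡ ballotPair (2 ℕ.+ k) d
  twoBlockCount-one d k = ℕₚ.+-cancelʳ-≡ (ballot3-sum d) _ _
    (trans (twoBlockCount-closed d 1 k) (cong (ballotPair (2 ℕ.+ k) d ℕ.+_) (ℕₚ.+-identityʳ _)))

-- At j = k = 0 the closed form is C² + x C⁵ - x C³ / (1 - x), where C² - x C³ / (1 - x) = 1 / (1 -
-- x).
twoBlockCount≡avoiderCount : ∀ n → twoBlockCount n 0 0 ≡ avoiderCount (suc n)
twoBlockCount≡avoiderCount zero    = refl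
twoBlockCount≡avoiderCount (suc n) = ℕₚ.+-cancelʳ-≡ (ballot3-sum (suc n)) _ _ (begin
  twoBlockCount (suc n) 0 0 ℕ.+ s     ≡⟨ twoBlockCount-closed (suc n) 0 0 ⟩
  ballot 2 (suc n) ℕ.+ ballot 5 n ℕ.+ 0   ≡⟨ ℕₚ.+-identityʳ _ ⟩
  ballot 2 (suc n) ℕ.+ ballot 5 n     ≡⟨ cong (ℕ._+ ballot 5 n) (ballot2≡1+ballot3-sum (suc n)) ⟩
  suc s ℕ.+ ballot 5 n                ≡⟨ cong suc (ℕₚ.+-comm s (ballot 5 n)) ⟩
  suc (ballot 5 n) ℕ.+ s              ∎)
  where
  open ≡-Reasoning
  s = ballot3-sum (suc n)

-- Insertion of a new minimum

-- Letters come in order of position, inequalities in order of value.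
data Forbidden (a b c d : ℕ) : Set where
  [1342] : a < d → d < b → b < c → Forbidden a b c d
  [1423] : a < c → c < d → d < b → Forbidden a b c d
  [2314] : c < a → a < b → b < d → Forbidden a b c d

-- These are the patterns that 1342 and 1423 leave after their 1.
data Unlayered (x y z : ℕ) : Set where
  [231] : z < x → x < y → Unlayered x y z
  [312] : y < z → z < x → Unlayered x y z

Avoiding : Word → Set
Avoiding w = ∀ {a b c d} → Forbidden a b c d → ¬ (a ∷ b ∷ c ∷ d ∷ [] ⊆ w)

Layered : Word → Set
Layered w = ∀ {x y z} → Unlayered x y z → ¬ (x ∷ y ∷ z ∷ [] ⊆ w)

-- Removing the 1 of 2314 leaves an ascent to its left and a larger letter to its right.
NoAscentBelow : Word → Word → Set
NoAscentBelow u v = ∀ {x y z} → x < y → y < z → x ∷ y ∷ [] ⊆ u → ¬ (z ∈ v)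

Decreasing : Word → Set
Decreasing w = ∀ {x y} → x ∷ y ∷ [] ⊆ w → y < x

record Active (u v : Word) : Set where
  constructor active
  field
    layered       : Layered v
    noAscentBelow : NoAscentBelow u v
open Active

pair : ∀ {x y : ℕ} {u v} → x ∈ u → y ∈ v → x ∷ y ∷ [] ⊆ u ++ v
pair x∈u y∈v = ⊆.++⁺ (from∈ x∈u) (from∈ y∈v)

⊆-insert⁻ : ∀ {m : ℕ} {v σ} u → σ ⊆ u ++ m ∷ v →
  σ ⊆ u ++ v ⊎ ∃₂ λ σ₁ σ₂ → σ ≡ σ₁ ++ m ∷ σ₂ × σ₁ ⊆ u × σ₂ ⊆ v
⊆-insert⁻ []      (_ ∷ʳ σ⊆)   = inj₁ σ⊆
⊆-insert⁻ []      (refl ∷ σ⊆) = inj₂ ([] , _ , refl , [] , σ⊆)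
⊆-insert⁻ (y ∷ u) (_ ∷ʳ σ⊆) with ⊆-insert⁻ u σ⊆
... | inj₁ σ⊆′                        = inj₁ (y ∷ʳ σ⊆′)
... | inj₂ (σ₁ , σ₂ , eq , σ₁⊆ , σ₂⊆) = inj₂ (σ₁ , σ₂ , eq , y ∷ʳ σ₁⊆ , σ₂⊆)
⊆-insert⁻ (y ∷ u) (refl ∷ σ⊆) with ⊆-insert⁻ u σ⊆
... | inj₁ σ⊆′                          = inj₁ (refl ∷ σ⊆′)
... | inj₂ (σ₁ , σ₂ , refl , σ₁⊆ , σ₂⊆) = inj₂ (y ∷ σ₁ , σ₂ , refl , refl ∷ σ₁⊆ , σ₂⊆)

-- The second case carries a letter `y`, so that equal cuts fall under the first case only.
++-split : ∀ {u v : Word} s {t} → u ++ v ≡ s ++ t →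
  (∃[ r ] s ≡ u ++ r × v ≡ r ++ t) ⊎ (∃₂ λ y r → u ≡ s ++ y ∷ r × t ≡ y ∷ r ++ v)
++-split {[]}    s       eq = inj₁ (s , refl , eq)
++-split {x ∷ u} []      eq = inj₂ (x , u , refl , sym eq)
++-split {x ∷ u} (y ∷ s) eq with refl , eq′ ← ∷-injective eq with ++-split {u} s eq′
... | inj₁ (r , refl , refl)     = inj₁ (r , refl , refl)
... | inj₂ (z , r , refl , refl) = inj₂ (z , r , refl , refl)

Above : ℕ → Word → Set
Above m w = ∀ {x} → x ∈ w → m < x

above-insert : ∀ {m v} u → Above (suc m) (u ++ v) → Above m (u ++ suc m ∷ v)
above-insert u above x∈ with ∈-++⁻ u x∈
... | inj₁ x∈u          = ℕₚ.<⇒≤ (above (∈-++⁺ˡ x∈u))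
... | inj₂ (here refl)  = ℕₚ.≤-refl
... | inj₂ (there x∈v)  = ℕₚ.<⇒≤ (above (∈-++⁺ʳ u x∈v))

avoiding-⊆ : ∀ {v w} → v ⊆ w → Avoiding w → Avoiding v
avoiding-⊆ v⊆w avoids f σ⊆v = avoids f (⊆-trans σ⊆v v⊆w)

active-⊆ : ∀ {u u′ v v′} → u ⊆ u′ → v ⊆ v′ → Active u′ v′ → Active u v
active-⊆ u⊆ v⊆ (active l n) = active
  (λ p σ⊆ → l p (⊆-trans σ⊆ v⊆))
  (λ x<y y<z σ⊆ z∈ → n x<y y<z (⊆-trans σ⊆ u⊆) (lookup-⊆ v⊆ z∈))

-- The least letter `m` can only be the 1 of a forbidden pattern. In 1342 and 1423 the other letters
-- would break the layering of `v`; in 2314 they would be an ascent of `u` below a letter of `v`.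
avoiding-insert : ∀ {m u v} → Above m (u ++ v) → Active u v →
                  Avoiding (u ++ v) → Avoiding (u ++ m ∷ v)
avoiding-insert {m} {u} {v} above (active l n) avoids f σ⊆ with ⊆-insert⁻ u σ⊆
... | inj₁ σ⊆′ = avoids f σ⊆′
... | inj₂ (σ₁ , σ₂ , eq , σ₁⊆ , σ₂⊆) = go σ₁ f eq σ₁⊆ σ₂⊆
  where
  aboveᵘ : ∀ {σ x} → σ ⊆ u → x ∈ σ → ¬ x < m
  aboveᵘ σ⊆ x∈ = ℕₚ.<-asym (above (∈-++⁺ˡ (to∈ (⊆-trans (from∈ x∈) σ⊆))))

  aboveᵛ : ∀ {σ x} → σ ⊆ v → x ∈ σ → ¬ x < m
  aboveᵛ σ⊆ x∈ = ℕₚ.<-asym (above (∈-++⁺ʳ u (to∈ (⊆-trans (from∈ x∈) σ⊆))))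

  go : ∀ {a b c d σ₂} σ₁ → Forbidden a b c d → a ∷ b ∷ c ∷ d ∷ [] ≡ σ₁ ++ m ∷ σ₂ →
       σ₁ ⊆ u → σ₂ ⊆ v → ⊥
  go [] ([1342] _ d<b b<c)     refl _ σ₂⊆ = l ([231] d<b b<c) σ₂⊆
  go [] ([1423] _ c<d d<b)     refl _ σ₂⊆ = l ([312] c<d d<b) σ₂⊆
  go [] ([2314] c<a _ _)       refl _ σ₂⊆ = aboveᵛ σ₂⊆ (there (here refl)) c<a
  go (_ ∷ []) ([1342] a<d d<b _) refl σ₁⊆ _ = aboveᵘ σ₁⊆ (here refl) (ℕₚ.<-trans a<d d<b)
  go (_ ∷ []) ([1423] a<c c<d d<b) refl σ₁⊆ _ =
    aboveᵘ σ₁⊆ (here refl) (ℕₚ.<-trans a<c (ℕₚ.<-trans c<d d<b))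
  go (_ ∷ []) ([2314] _ a<b _) refl σ₁⊆ _ = aboveᵘ σ₁⊆ (here refl) a<b
  go (_ ∷ _ ∷ []) ([1342] a<d d<b b<c) refl σ₁⊆ _ =
    aboveᵘ σ₁⊆ (there (here refl)) b<c
  go (_ ∷ _ ∷ []) ([1423] a<c _ _) refl σ₁⊆ _ = aboveᵘ σ₁⊆ (here refl) a<c
  go (_ ∷ _ ∷ []) ([2314] _ a<b b<d) refl σ₁⊆ σ₂⊆ = n a<b b<d σ₁⊆ (to∈ σ₂⊆)
  go (_ ∷ _ ∷ _ ∷ []) ([1342] a<d _ _) refl σ₁⊆ _ = aboveᵘ σ₁⊆ (here refl) a<d
  go (_ ∷ _ ∷ _ ∷ []) ([1423] _ c<d _) refl σ₁⊆ _ = aboveᵘ σ₁⊆ (there (there (here refl))) c<d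
  go (_ ∷ _ ∷ _ ∷ []) ([2314] _ _ b<d) refl σ₁⊆ _ = aboveᵘ σ₁⊆ (there (here refl)) b<d
  go (_ ∷ _ ∷ _ ∷ _ ∷ []) _ () _ _
  go (_ ∷ _ ∷ _ ∷ _ ∷ _ ∷ _) _ () _ _

avoiding-insert⁻ : ∀ {m u v} → Above m (u ++ v) → Avoiding (u ++ m ∷ v) → Active u v
avoiding-insert⁻ {m} {u} {v} above avoids = active layered′ noAscentBelow′
  where
  aboveᵛ : ∀ {σ x} → σ ⊆ v → x ∈ σ → m < x
  aboveᵛ σ⊆ x∈ = above (∈-++⁺ʳ u (to∈ (⊆-trans (from∈ x∈) σ⊆)))

  layered′ : Layered v
  layered′ ([231] z<x x<y) σ⊆ =
    avoids ([1342] (aboveᵛ σ⊆ (there (there (here refl)))) z<x x<y) (⊆.++⁺ˡ u (refl ∷ σ⊆))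
  layered′ ([312] y<z z<x) σ⊆ =
    avoids ([1423] (aboveᵛ σ⊆ (there (here refl))) y<z z<x) (⊆.++⁺ˡ u (refl ∷ σ⊆))

  noAscentBelow′ : NoAscentBelow u v
  noAscentBelow′ x<y y<z xy⊆ z∈ = avoids
    ([2314] (above (∈-++⁺ˡ (to∈ (⊆-trans (from∈ (here refl)) xy⊆)))) x<y y<z)
    (⊆.++⁺ xy⊆ (refl ∷ from∈ z∈))

-- Keeps places to the left of `m` active. The minimum could only be the 1 of a 231, whose 23 would
-- be an ascent of `r`, or the 1 of a 312, whose 3 in `r` would exceed its 2 in `v`.
active-before : ∀ {m u v} r → Above m (u ++ r ++ v) → Decreasing r →
  (∀ {x y} → x ∈ r → y ∈ v → x < y) → Active u (r ++ v) → Active u (r ++ m ∷ v)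
active-before {m} {u} {v} r above dec r<v (active l n) = active layered′ noAscentBelow′
  where
  aboveʳ : ∀ {σ x} → σ ⊆ r → x ∈ σ → ¬ x < m
  aboveʳ σ⊆ x∈ = ℕₚ.<-asym (above (∈-++⁺ʳ u (∈-++⁺ˡ (to∈ (⊆-trans (from∈ x∈) σ⊆)))))

  aboveᵛ : ∀ {σ x} → σ ⊆ v → x ∈ σ → ¬ x < m
  aboveᵛ σ⊆ x∈ = ℕₚ.<-asym (above (∈-++⁺ʳ u (∈-++⁺ʳ r (to∈ (⊆-trans (from∈ x∈) σ⊆)))))

  go : ∀ {x y z σ₂} σ₁ → Unlayered x y z → x ∷ y ∷ z ∷ [] ≡ σ₁ ++ m ∷ σ₂ → σ₁ ⊆ r → σ₂ ⊆ v → ⊥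
  go [] ([231] z<x _) refl _ σ₂⊆ = aboveᵛ σ₂⊆ (there (here refl)) z<x
  go [] ([312] y<z z<x) refl _ σ₂⊆ = aboveᵛ σ₂⊆ (here refl) (ℕₚ.<-trans y<z z<x)
  go (_ ∷ []) ([231] _ x<y) refl σ₁⊆ _ = aboveʳ σ₁⊆ (here refl) x<y
  go (_ ∷ []) ([312] _ z<x) refl σ₁⊆ σ₂⊆ = ℕₚ.<-asym z<x (r<v (to∈ σ₁⊆) (to∈ σ₂⊆))
  go (_ ∷ _ ∷ []) ([231] _ x<y) refl σ₁⊆ _ = ℕₚ.<-asym x<y (dec σ₁⊆)
  go (_ ∷ _ ∷ []) ([312] y<z _) refl σ₁⊆ _ = aboveʳ σ₁⊆ (there (here refl)) y<z
  go (_ ∷ _ ∷ _ ∷ []) _ () _ _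
  go (_ ∷ _ ∷ _ ∷ _ ∷ _) _ () _ _

  layered′ : Layered (r ++ m ∷ v)
  layered′ p σ⊆ with ⊆-insert⁻ r σ⊆
  ... | inj₁ σ⊆′ = l p σ⊆′
  ... | inj₂ (σ₁ , σ₂ , eq , σ₁⊆ , σ₂⊆) = go σ₁ p eq σ₁⊆ σ₂⊆

  noAscentBelow′ : NoAscentBelow u (r ++ m ∷ v)
  noAscentBelow′ x<y y<z xy⊆ z∈ with ∈-++⁻ r z∈
  ... | inj₁ z∈r         = n x<y y<z xy⊆ (∈-++⁺ˡ z∈r)
  ... | inj₂ (there z∈v) = n x<y y<z xy⊆ (∈-++⁺ʳ r z∈v)
  ... | inj₂ (here refl) =
    ℕₚ.<-asym y<z (above (∈-++⁺ˡ (to∈ (⊆.∷ˡ⁻ xy⊆))))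

-- Keeps places to the right of `m` active. The new ascents before such a place are `m y` with `y`
-- in `r`, and no letter of `v` exceeds `y`.
active-after : ∀ {m u v} r → Above m ((u ++ r) ++ v) →
  (∀ {y z} → y ∈ r → z ∈ v → ¬ y < z) → Active (u ++ r) v → Active (u ++ m ∷ r) v
active-after {m} {u} {v} r above r≮v (active l n) = active l noAscentBelow′
  where
  go : ∀ {x y z σ₂} σ₁ → x < y → y < z → x ∷ y ∷ [] ≡ σ₁ ++ m ∷ σ₂ →
       σ₁ ⊆ u → σ₂ ⊆ r → z ∈ v → ⊥
  go []          x<y y<z refl _   σ₂⊆ z∈ = r≮v (to∈ σ₂⊆) z∈ y<z
  go (_ ∷ [])    x<y y<z refl σ₁⊆ _   z∈ = ℕₚ.<-asym x<y (above (∈-++⁺ˡ (∈-++⁺ˡ (to∈ σ₁⊆))))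
  go (_ ∷ _ ∷ []) _ _ () _ _ _
  go (_ ∷ _ ∷ _ ∷ _) _ _ () _ _ _

  noAscentBelow′ : NoAscentBelow (u ++ m ∷ r) v
  noAscentBelow′ x<y y<z xy⊆ z∈ with ⊆-insert⁻ u xy⊆
  ... | inj₁ xy⊆′                       = n x<y y<z xy⊆′ z∈
  ... | inj₂ (σ₁ , σ₂ , eq , σ₁⊆ , σ₂⊆) = go σ₁ x<y y<z eq σ₁⊆ σ₂⊆ z∈

-- The places are those immediately before a letter of `v`. The right end of `v` is left out so that
-- adjacent segments share no place.
DeadSites : Word → Word → Word → Set
DeadSites p v q = ∀ {v₁ y v₂} → v ≡ v₁ ++ y ∷ v₂ → ¬ Active (p ++ v₁) (y ∷ v₂ ++ q)

-- Later insertions never revive a place, because activity passes to subsequences.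
dead-⊆ : ∀ {p p′ q q′ v} → p ⊆ p′ → q ⊆ q′ → DeadSites p v q → DeadSites p′ v q′
dead-⊆ p⊆ q⊆ dead {v₁} {y} {v₂} eq a =
  dead eq (active-⊆ (⊆.++⁺ p⊆ ⊆-refl) (⊆.++⁺ (⊆-refl {x = y ∷ v₂}) q⊆) a)

dead-++ : ∀ {p q w} v → DeadSites p v (w ++ q) → DeadSites (p ++ v) w q → DeadSites p (v ++ w) q
dead-++ {p} {q} {w} v deadᵛ deadʷ {v₁} {y} {v₂} eq a with ++-split {v₁} v (sym eq)
... | inj₁ (y′ ∷ r , refl , refl) = deadᵛ refl (subst (λ u → Active _ (y ∷ u)) (++-assoc r w q) a)
... | inj₁ ([] , refl , refl) = deadʷ {[]} refl (subst (λ u → Active u _)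
  (trans (cong (p ++_) (sym (++-identityʳ v₁))) (sym (++-identityʳ _))) a)
... | inj₂ (z , r , refl , refl) = deadʷ refl (subst (λ u → Active u _) (sym (++-assoc p v (z ∷ r))) a)

dead-∷ : ∀ {p v q y} → ¬ Active p (y ∷ v ++ q) → DeadSites (p ++ [ y ]) v q → DeadSites p (y ∷ v) q
dead-∷ {p} {y = y} dead₁ dead {[]} refl a = dead₁ (subst (λ u → Active u _) (++-identityʳ p) a)
dead-∷ {p} {y = y} dead₁ dead {_ ∷ v₁} refl a = dead refl (subst (λ u → Active u _) (sym (++-assoc p [ y ] v₁)) a)

dead-unlayered : ∀ {p v q} → (∀ {v₁ y v₂} → v ≡ v₁ ++ y ∷ v₂ → ¬ Layered (y ∷ v₂ ++ q)) → DeadSites p v q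
dead-unlayered unlayered eq a = unlayered eq (layered a)

dead-ascent : ∀ {x y p v q} → x < y → x ∷ y ∷ [] ⊆ p →
  (∀ {v₁ s v₂} → v ≡ v₁ ++ s ∷ v₂ → ∃[ z ] z ∈ s ∷ v₂ ++ q × y < z) → DeadSites p v q
dead-ascent x<y xy⊆ larger {v₁} eq a =
  let z , z∈ , y<z = larger eq in noAscentBelow a x<y y<z (⊆.++⁺ʳ v₁ xy⊆) z∈

-- Sizes of predicates by explicit enumeration

record _HasSize_ {A : Set} (P : Pred A 0ℓ) (n : ℕ) : Set where
  field
    enumeration : Enumeration P
    size        : Enumeration.card enumeration ≡ n

module _ {A : Set} where

  size-∅ : {P : Pred A 0ℓ} → (∀ {x} → ¬ P x) → P HasSize 0
  size-∅ ¬P = record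
    { enumeration = record
      { elements   = []
      ; unique     = []
      ; enumerates = mk⇔ (λ ()) (λ p → contradiction p ¬P)
      }
    ; size = refl
    }

  size-singleton : {P : Pred A 0ℓ} {x : A} → P x → (∀ {y} → P y → y ≡ x) → P HasSize 1
  size-singleton {P} {x} px P⇒≡x = record
    { enumeration = record
      { elements   = x ∷ []
      ; unique     = [] ∷ []
      ; enumerates = mk⇔ (λ { (here refl) → px }) (λ p → here (P⇒≡x p))
      }
    ; size = refl
    }

  size-⊎ : {P Q R : Pred A 0ℓ} {m n : ℕ} → P HasSize m → Q HasSize n →
           (∀ {x} → P x → ¬ Q x) → (∀ {x} → (P x ⊎ Q x) ⇔ R x) → R HasSize (m ℕ.+ n)
  size-⊎ {P} {Q} {R} p q disjoint P⊎Q⇔R = record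
    { enumeration = record
      { elements   = p.elements ++ q.elements
      ; unique     = Unique.++⁺ p.unique q.unique
          (λ (x∈p , x∈q) → disjoint (to p.enumerates x∈p) (to q.enumerates x∈q))
      ; enumerates = mk⇔ sound complete
      }
    ; size = trans (length-++ p.elements) (cong₂ ℕ._+_ (_HasSize_.size p) (_HasSize_.size q))
    }
    where
    open Equivalence
    module p = Enumeration (_HasSize_.enumeration p)
    module q = Enumeration (_HasSize_.enumeration q)

    sound : ∀ {x} → x ∈ p.elements ++ q.elements → R x
    sound x∈ with ∈-++⁻ p.elements x∈
    ... | inj₁ x∈p = to P⊎Q⇔R (inj₁ (to p.enumerates x∈p))
    ... | inj₂ x∈q = to P⊎Q⇔R (inj₂ (to q.enumerates x∈q))

    complete : ∀ {x} → R x → x ∈ p.elements ++ q.elements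
    complete r with from P⊎Q⇔R r
    ... | inj₁ px = ∈-++⁺ˡ (from p.enumerates px)
    ... | inj₂ qx = ∈-++⁺ʳ p.elements (from q.enumerates qx)

  size-⇔ : {P Q : Pred A 0ℓ} {n : ℕ} → (∀ {x} → P x ⇔ Q x) → P HasSize n → Q HasSize n
  size-⇔ P⇔Q p = record
    { enumeration = record
      { elements   = p.elements
      ; unique     = p.unique
      ; enumerates = mk⇔ (to P⇔Q ∘ to p.enumerates) (from p.enumerates ∘ from P⇔Q)
      }
    ; size = _HasSize_.size p
    }
    where
    open Equivalence
    module p = Enumeration (_HasSize_.enumeration p)

-- For w with all values above m: π is an avoider obtained from w by inserting
-- m, m - 1, …, 1.
record Descendant (m : ℕ) (w π : Word) : Set where
  constructor descendant
  field
    restrict : filter (m ℕₚ.<?_) π ≡ w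
    perm     : π ↭ applyUpTo suc m ++ w
    avoids   : Avoiding π
open Descendant

-- Descendants and the insertion of the next value

filter-above : ∀ {m w} → Above m w → filter (m ℕₚ.<?_) w ≡ w
filter-above above = filter-all _ (All.tabulate above)

filter-filter : ∀ {P Q : Pred ℕ 0ℓ} (P? : Decidable P) (Q? : Decidable Q) → (∀ {x} → P x → Q x) →
                ∀ w → filter P? (filter Q? w) ≡ filter P? w
filter-filter P? Q? P⇒Q []      = refl
filter-filter P? Q? P⇒Q (x ∷ w) with Q? x
... | no ¬q = trans (filter-filter P? Q? P⇒Q w) (sym (filter-reject P? (¬q ∘ P⇒Q)))
... | yes _ with P? x
...   | yes _ = cong (x ∷_) (filter-filter P? Q? P⇒Q w)
...   | no  _ = filter-filter P? Q? P⇒Q w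

filter-suc : ∀ m w → filter (suc m ℕₚ.<?_) (filter (m ℕₚ.<?_) w) ≡ filter (suc m ℕₚ.<?_) w
filter-suc m = filter-filter (suc m ℕₚ.<?_) (m ℕₚ.<?_) ℕₚ.<⇒≤

filter-insert : ∀ {m v} u → Above (suc m) (u ++ v) → filter (suc m ℕₚ.<?_) (u ++ suc m ∷ v) ≡ u ++ v
filter-insert {m} {v} u above = begin
  filter P? (u ++ suc m ∷ v)          ≡⟨ filter-++ P? u (suc m ∷ v) ⟩
  filter P? u ++ filter P? (suc m ∷ v) ≡⟨ cong (filter P? u ++_) (filter-reject P? (ℕₚ.<-irrefl refl)) ⟩
  filter P? u ++ filter P? v          ≡⟨ filter-++ P? u v ⟨
  filter P? (u ++ v)                  ≡⟨ filter-above above ⟩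
  u ++ v                              ∎
  where
  open ≡-Reasoning
  P? = suc m ℕₚ.<?_

descendant-insert : ∀ {m π v} u → Above (suc m) (u ++ v) →
  Descendant m (u ++ suc m ∷ v) π → Descendant (suc m) (u ++ v) π
descendant-insert {m} {π} {v} u above (descendant restrict perm avoids) = descendant
  (trans (sym (filter-suc m π)) (trans (cong (filter (suc m ℕₚ.<?_)) restrict) (filter-insert u above)))
  (↭-trans perm (↭-trans (++⁺ˡ (applyUpTo suc m) (shift (suc m) u v)) (↭-reflexive
    (trans (sym (++-assoc (applyUpTo suc m) [ suc m ] (u ++ v)))
           (cong (_++ u ++ v) (applyUpTo-∷ʳ suc m))))))
  avoids

-- The letters of `π` above `m` are those of `w` together with `suc m`; the place of `suc m` among
-- them is where it was inserted.
descendant-insert⁻ : ∀ {m w π} → Above (suc m) w → Descendant (suc m) w π →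
  ∃₂ λ u v → w ≡ u ++ v × Descendant m (u ++ suc m ∷ v) π
descendant-insert⁻ {m} {w} {π} above (descendant restrict perm avoids) =
  let u , v , eq = ∈-∃++ 1+m∈ in
  u , v , w≡ u eq , descendant eq (↭-trans perm′ (↭-reflexive′ u v (w≡ u eq))) avoids
  where
  P? = m ℕₚ.<?_

  perm′ : π ↭ applyUpTo suc m ++ suc m ∷ w
  perm′ = ↭-trans perm (↭-reflexive (trans
    (cong (_++ w) (sym (applyUpTo-∷ʳ suc m))) (++-assoc (applyUpTo suc m) [ suc m ] w)))

  above′ : Above m (suc m ∷ w)
  above′ (here refl) = ℕₚ.≤-refl
  above′ (there x∈)  = ℕₚ.<⇒≤ (above x∈)

  filter↭ : filter P? π ↭ suc m ∷ w
  filter↭ = ↭-trans (filter-↭ P? perm′) (↭-reflexive (begin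
    filter P? (applyUpTo suc m ++ suc m ∷ w)         ≡⟨ filter-++ P? (applyUpTo suc m) _ ⟩
    filter P? (applyUpTo suc m) ++ filter P? (suc m ∷ w)
      ≡⟨ cong₂ _++_ (filter-none P? (All.applyUpTo⁺₁ suc m ℕₚ.≤⇒≯)) (filter-above above′) ⟩
    suc m ∷ w                                        ∎))
    where open ≡-Reasoning

  1+m∈ : suc m ∈ filter P? π
  1+m∈ = ∈-resp-↭ (↭-sym filter↭) (here refl)

  w≡ : ∀ u {v} → filter P? π ≡ u ++ suc m ∷ v → w ≡ u ++ v
  w≡ u {v} eq = begin
    w                                        ≡⟨ restrict ⟨
    filter (suc m ℕₚ.<?_) π                  ≡⟨ filter-suc m π ⟨
    filter (suc m ℕₚ.<?_) (filter P? π)      ≡⟨ cong (filter (suc m ℕₚ.<?_)) eq ⟩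
    filter (suc m ℕₚ.<?_) (u ++ suc m ∷ v)   ≡⟨ filter-insert u above″ ⟩
    u ++ v                                   ∎
    where
    open ≡-Reasoning
    above″ : Above (suc m) (u ++ v)
    above″ = above ∘ ∈-resp-↭ (drop-∷ (↭-trans (↭-sym (shift (suc m) u v)) (↭-trans (↭-reflexive (sym eq)) filter↭)))

  ↭-reflexive′ : ∀ u v → w ≡ u ++ v → applyUpTo suc m ++ suc m ∷ w ↭ applyUpTo suc m ++ u ++ suc m ∷ v
  ↭-reflexive′ u v refl = ++⁺ˡ (applyUpTo suc m) (↭-sym (shift (suc m) u v))

-- Restriction recovers the ancestor from `π`, so distinct children have disjoint sets of
-- descendants.
descendant-functional : ∀ {m w w′ π} → Descendant m w π → Descendant m w′ π → w ≡ w′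
descendant-functional d d′ = trans (sym (restrict d)) (restrict d′)

size-descendant-zero : ∀ {w} → Above 0 w → Avoiding w → Descendant 0 w HasSize 1
size-descendant-zero above avoids = size-singleton
  (descendant (filter-above above) ↭-refl avoids)
  (λ d → trans (sym (filter-above (above ∘ ∈-resp-↭ (perm d)))) (restrict d))

-- By filtering, the child is a subsequence of each of its descendants. A single descendant would
-- therefore make the child avoiding and the place active.
size-inactive : ∀ {m u v} → Above (suc m) (u ++ v) → ¬ Active u v →
                Descendant m (u ++ suc m ∷ v) HasSize 0
size-inactive {m} above inactive = size-∅ λ {π} d → inactive (avoiding-insert⁻ above
  (avoiding-⊆ (subst (_⊆ π) (restrict d) (⊆.filter-⊆ (m ℕₚ.<?_) π)) (avoids d)))

-- The union over the places in `v`, both ends included, after the part `p` already passed. It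
-- allows the places of a word to be processed from left to right.
Inserted : ℕ → Word → Word → Pred Word 0ℓ
Inserted m p v π = ∃₂ λ v₁ v₂ → v ≡ v₁ ++ v₂ × Descendant m ((p ++ v₁) ++ suc m ∷ v₂) π

size-inserted-[] : ∀ {m p n} → Descendant m (p ++ [ suc m ]) HasSize n → Inserted m p [] HasSize n
size-inserted-[] {m} {p} = size-⇔ (mk⇔
  (λ d → [] , [] , refl , subst (λ u → Descendant m (u ++ [ suc m ]) _) (sym (++-identityʳ p)) d)
  (λ { ([] , [] , refl , d) → subst (λ u → Descendant m (u ++ [ suc m ]) _) (++-identityʳ p) d }))

size-inserted-∷ : ∀ {m p y v k n} → suc m < y →
  Descendant m (p ++ suc m ∷ y ∷ v) HasSize k → Inserted m (p ++ [ y ]) v HasSize n →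
  Inserted m p (y ∷ v) HasSize (k ℕ.+ n)
size-inserted-∷ {m} {p} {y} {v} m<y first rest = size-⊎ first rest disjoint (mk⇔ to from)
  where
  disjoint : ∀ {π} → Descendant m (p ++ suc m ∷ y ∷ v) π → ¬ Inserted m (p ++ [ y ]) v π
  -- After the common prefix `p`, one child continues with `suc m` and the other with `y`.
  disjoint d (v₁ , v₂ , refl , d′) = ℕₚ.<⇒≢ m<y (∷-injectiveˡ (++-cancelˡ p _ _ (trans
    (descendant-functional d d′)
    (trans (cong (_++ suc m ∷ v₂) (++-assoc p [ y ] v₁)) (++-assoc p (y ∷ v₁) (suc m ∷ v₂))))))

  to : ∀ {π} → Descendant m (p ++ suc m ∷ y ∷ v) π ⊎ Inserted m (p ++ [ y ]) v π → Inserted m p (y ∷ v) π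
  to (inj₁ d) = [] , y ∷ v , refl , subst (λ u → Descendant m (u ++ suc m ∷ y ∷ v) _) (sym (++-identityʳ p)) d
  to (inj₂ (v₁ , v₂ , refl , d)) =
    y ∷ v₁ , v₂ , refl , subst (λ u → Descendant m (u ++ suc m ∷ v₂) _) (++-assoc p [ y ] v₁) d

  from : ∀ {π} → Inserted m p (y ∷ v) π → Descendant m (p ++ suc m ∷ y ∷ v) π ⊎ Inserted m (p ++ [ y ]) v π
  from ([] , _ , refl , d) = inj₁ (subst (λ u → Descendant m (u ++ suc m ∷ y ∷ v) _) (++-identityʳ p) d)
  from (_ ∷ v₁ , v₂ , refl , d) =
    inj₂ (v₁ , v₂ , refl , subst (λ u → Descendant m (u ++ suc m ∷ v₂) _) (sym (++-assoc p [ y ] v₁)) d)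

-- The places before the letters of `v` are split off one by one. `f` receives the number of letters
-- of `v` beyond the one that follows the place, which falls in step with the descending order of
-- `sumBelow`. The right end of `v` belongs to the last hypothesis.
size-inserted-++ : ∀ {m n} (f : ℕ → ℕ) p v q → Above (suc m) v →
  (∀ {v₁ y v₂} → v ≡ v₁ ++ y ∷ v₂ →
    Descendant m ((p ++ v₁) ++ suc m ∷ y ∷ v₂ ++ q) HasSize f (length v₂)) →
  Inserted m (p ++ v) q HasSize n → Inserted m p (v ++ q) HasSize (sumBelow f (length v) ℕ.+ n)
size-inserted-++ {m} {n} f p []      q above sizes rest =
  subst (λ u → Inserted m u q HasSize n) (++-identityʳ p) rest
size-inserted-++ {m} {n} f p (y ∷ v) q above sizes rest = subst (Inserted m p (y ∷ v ++ q) HasSize_)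
  (sym (ℕₚ.+-assoc (f (length v)) _ n))
  (size-inserted-∷ (above (here refl))
    (subst (λ u → Descendant m (u ++ suc m ∷ y ∷ v ++ q) HasSize f (length v)) (++-identityʳ p) (sizes refl))
    (size-inserted-++ f (p ++ [ y ]) v q (above ∘ there)
      (λ { {v₁} {z} {v₂} refl → subst (λ u → Descendant m (u ++ suc m ∷ z ∷ v₂ ++ q) HasSize f (length v₂))
        (sym (++-assoc p [ y ] v₁)) (sizes refl) })
      (subst (λ u → Inserted m u q HasSize n) (sym (++-assoc p [ y ] v)) rest)))

size-inserted-dead : ∀ {m n} p v q → Above (suc m) (p ++ v ++ q) → DeadSites p v q →
  Inserted m (p ++ v) q HasSize n → Inserted m p (v ++ q) HasSize n
size-inserted-dead {m} {n} p v q above dead rest = subst (Inserted m p (v ++ q) HasSize_)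
  (cong (ℕ._+ n) (sumBelow-zero (length v)))
  (size-inserted-++ (λ _ → 0) p v q (above ∘ ∈-++⁺ʳ p ∘ ∈-++⁺ˡ)
    (λ { {v₁} {y} {v₂} refl → size-inactive
       (above ∘ subst (_ ∈_) (trans (++-assoc p v₁ (y ∷ v₂ ++ q)) (cong (p ++_) (sym (++-assoc v₁ (y ∷ v₂) q)))))
       (dead refl) })
    rest)
  where
  sumBelow-zero : ∀ k → sumBelow (λ _ → 0) k ≡ 0
  sumBelow-zero zero    = refl
  sumBelow-zero (suc k) = sumBelow-zero k

size-descendant-suc : ∀ {m w n} → Above (suc m) w → Inserted m [] w HasSize n → Descendant (suc m) w HasSize n
size-descendant-suc above = size-⇔ (mk⇔
  (λ { (u , v , refl , d) → descendant-insert u above d })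
  (descendant-insert⁻ above))

-- The nodes of the generating tree

-- The part common to both kinds of node, with a nonempty right-hand block `q ∷ Q`. The `sites` run
-- from the left end of `A` to the place before `q`, both included.
record Block (m : ℕ) (P A : Word) (q : ℕ) (Q : Word) : Set where
  field
    avoiding   : Avoiding (P ++ A ++ q ∷ Q)
    above      : Above m (P ++ A ++ q ∷ Q)
    decreasing : Decreasing A
    A<Q        : ∀ {x y} → x ∈ A → y ∈ q ∷ Q → x < y
    deadᴾ      : DeadSites [] P (A ++ q ∷ Q)
    sites      : ∀ {u v} → A ≡ u ++ v → Active (P ++ u) (v ++ q ∷ Q)

-- `sitesᴮ` starts after `b`, as the place before `b` is among the `sites` of the block.
record TwoBlocks (m : ℕ) (P A : Word) (b : ℕ) (B : Word) : Set where
  field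
    block       : Block m P A b B
    decreasingᴮ : Decreasing (b ∷ B)
    sitesᴮ      : ∀ {u v} → B ≡ u ++ v → Active ((P ++ A) ++ b ∷ u) v

-- `deadᴽ` covers the places inside `q ∷ Q`; the right end is active by `last-active`.
record BlockAscent (m : ℕ) (P A : Word) (q : ℕ) (Q : Word) : Set where
  field
    block  : Block m P A q Q
    ascent : ∃₂ λ y z → y < z × y ∷ z ∷ [] ⊆ q ∷ Q
    deadᴽ  : DeadSites ((P ++ A) ++ [ q ]) Q []

decreasing-⊆ : ∀ {u v} → u ⊆ v → Decreasing v → Decreasing u
decreasing-⊆ u⊆v dec xy⊆ = dec (⊆-trans xy⊆ u⊆v)

decreasing-∷ʳ : ∀ {m u} → (∀ {x} → x ∈ u → m < x) → Decreasing u → Decreasing (u ++ [ m ])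
decreasing-∷ʳ {m} {u} m<u dec xy⊆ with ⊆-insert⁻ u xy⊆
... | inj₁ xy⊆u = dec (subst (_ ⊆_) (++-identityʳ u) xy⊆u)
... | inj₂ ([] , _ , refl , _ , ())
... | inj₂ (_ ∷ [] , _ , refl , x⊆ , _) = m<u (to∈ x⊆)
... | inj₂ (_ ∷ _ ∷ [] , _ , () , _)
... | inj₂ (_ ∷ _ ∷ _ ∷ _ , _ , () , _)

¬-decreasing-ascent : ∀ {u v y z} → Decreasing (u ++ v) → y ∈ u → z ∈ v → ¬ y < z
¬-decreasing-ascent dec y∈ z∈ = ℕₚ.<-asym (dec (pair y∈ z∈))

decreasing-[] : Decreasing []
decreasing-[] ()

decreasing-[-] : ∀ {x} → Decreasing [ x ]
decreasing-[-] (_ ∷ʳ ())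
decreasing-[-] (_ ∷ ())

last-active : ∀ {u} → Active u []
last-active = active (λ _ ()) (λ _ _ _ ())

module _ {m P A q Q} (B : Block (suc m) P A q Q) where
  open Block B

  private
    x = suc m
    w = P ++ A ++ q ∷ Q

    insert : ∀ {u v} → w ≡ u ++ v → Active u v → Avoiding (u ++ x ∷ v) × Above m (u ++ x ∷ v)
    insert {u} eq a =
      avoiding-insert (subst (Above _) eq (λ y∈ → above y∈)) a (subst (λ u → Avoiding u) eq avoiding) ,
      above-insert u (subst (Above _) eq above)

    m<A : ∀ {y} → y ∈ A → x < y
    m<A = above ∘ ∈-++⁺ʳ P ∘ ∈-++⁺ˡ

    m<Q : ∀ {y} → y ∈ q ∷ Q → x < y
    m<Q = above ∘ ∈-++⁺ʳ P ∘ ∈-++⁺ʳ A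

    site-word : ∀ {u v} → A ≡ u ++ v → w ≡ (P ++ u) ++ v ++ q ∷ Q
    site-word {u} {v} refl = trans (cong (P ++_) (++-assoc u v (q ∷ Q))) (sym (++-assoc P u _))

    above-site : ∀ {u v} → A ≡ u ++ v → Above x ((P ++ u) ++ v ++ q ∷ Q)
    above-site eq = subst (Above x) (site-word eq) above

  -- Placed after `A`, the new minimum prolongs the decreasing block below `q ∷ Q`. Both kinds of
  -- node use this child.
  insert-between : Block m P (A ++ [ x ]) q Q
  insert-between = record
    { avoiding   = subst (λ u → Avoiding u) eq (proj₁ inserted)
    ; above      = subst (Above m) eq (proj₂ inserted)
    ; decreasing = decreasing-∷ʳ m<A decreasing
    ; A<Q        = A<Q′
    ; deadᴾ      = dead-⊆ ⊆-refl (⊆.++⁺ (⊆.++⁺ʳ [ x ] (⊆-refl {x = A})) ⊆-refl) deadᴾ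
    ; sites      = sites′
    }
    where
    inserted = insert (site-word (sym (++-identityʳ A))) (sites (sym (++-identityʳ A)))

    eq : (P ++ A) ++ x ∷ q ∷ Q ≡ P ++ (A ++ [ x ]) ++ q ∷ Q
    eq = trans (++-assoc P A _) (cong (P ++_) (sym (++-assoc A [ x ] (q ∷ Q))))

    A<Q′ : ∀ {y z} → y ∈ A ++ [ x ] → z ∈ q ∷ Q → y < z
    A<Q′ y∈ z∈ with ∈-++⁻ A y∈
    ... | inj₁ y∈A         = A<Q y∈A z∈
    ... | inj₂ (here refl) = m<Q z∈

    sites′ : ∀ {u v} → A ++ [ x ] ≡ u ++ v → Active (P ++ u) (v ++ q ∷ Q)
    sites′ {u} eq with ++-split {u} A (sym eq)
    -- The old places lie to the left of `x`.
    ... | inj₁ (r , A≡ , refl) = subst (Active (P ++ u)) (sym (++-assoc r [ x ] (q ∷ Q)))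
      (active-before r (above-site A≡)
        (decreasing-⊆ (subst (r ⊆_) (sym A≡) (⊆.++⁺ˡ u ⊆-refl)) decreasing)
        (λ y∈ → A<Q (subst (_ ∈_) (sym A≡) (∈-++⁺ʳ u y∈)))
        (sites A≡))
    -- The place between `x` and `q` lies to the right of `x`.
    ... | inj₂ (_ , [] , refl , refl) = subst (λ u → Active u (q ∷ Q)) (++-assoc P A [ x ])
      (active-after {u = P ++ A} []
        (subst (λ u → Above x (u ++ q ∷ Q)) (sym (++-identityʳ (P ++ A))) (above-site (sym (++-identityʳ A))))
        (λ ())
        (subst (λ u → Active u (q ∷ Q)) (sym (++-identityʳ (P ++ A))) (sites (sym (++-identityʳ A)))))

  -- For `t` in `A₁` the letters `t x a` form a 312, which kills the place before `t`. The ascent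
  -- `x a` kills each later place with a letter above `a` to its right: `q` serves up to the place
  -- before `q`, and inside `Q` the places are either dead already (BlockAscent) or followed by such
  -- a letter (TwoBlocks). The two sides of `x` and the right end remain.
  insert-before : ∀ {A₁ a A₂} → A ≡ A₁ ++ a ∷ A₂ →
                  DeadSites ((P ++ A) ++ [ q ]) Q [] ⊎ (∀ {z} → z ∈ Q → a < z) →
                  BlockAscent m (P ++ A₁) [ x ] a (A₂ ++ q ∷ Q)
  insert-before {A₁} {a} {A₂} refl dead⊎large = record
    { block  = record
      { avoiding   = proj₁ inserted
      ; above      = proj₂ inserted
      ; decreasing = decreasing-[-]
      ; A<Q        = λ { (here refl) → x<R }
      ; deadᴾ      = dead-++ {w = A₁} P
          (dead-⊆ {q = (A₁ ++ a ∷ A₂) ++ q ∷ Q} ⊆-refl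
            (⊆-trans (⊆-reflexive (++-assoc A₁ (a ∷ A₂) (q ∷ Q))) (⊆.++⁺ (⊆-refl {x = A₁}) (x ∷ʳ ⊆-refl))) deadᴾ)
          (dead-unlayered λ { {s₁} {t} {s₂} refl l →
            l ([312] x<a (decreasing (a<t s₁ s₂))) (refl ∷ ⊆.++⁺ˡ s₂ (refl ∷ refl ∷ minimum _)) })
      ; sites      = sites′
      }
    ; ascent = a , q , a<q , refl ∷ from∈ (∈-++⁺ʳ A₂ (here refl))
    ; deadᴽ  = dead-++ A₂
        (dead-ascent x<a xa⊆ (λ { {s₁} {s} {s₂} refl → q , there (∈-++⁺ʳ s₂ (here refl)) , a<q }))
        (dead-∷
          (λ active → noAscentBelow active x<a a<q (⊆.++⁺ʳ A₂ xa⊆) (here refl))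
          (deadQ dead⊎large))
    }
    where
    inserted = insert (site-word refl) (sites refl)

    x<a : x < a
    x<a = m<A (∈-++⁺ʳ A₁ (here refl))

    a<q : a < q
    a<q = A<Q (∈-++⁺ʳ A₁ (here refl)) (here refl)

    x<R : ∀ {y} → y ∈ a ∷ A₂ ++ q ∷ Q → x < y
    x<R y∈ with ∈-++⁻ (a ∷ A₂) y∈
    ... | inj₁ y∈A = m<A (∈-++⁺ʳ A₁ y∈A)
    ... | inj₂ y∈Q = m<Q y∈Q

    a<t : ∀ {t} s₁ s₂ → t ∷ a ∷ [] ⊆ (s₁ ++ t ∷ s₂) ++ a ∷ A₂
    a<t s₁ s₂ = pair (∈-++⁺ʳ s₁ (here refl)) (here refl)

    xa⊆ : x ∷ a ∷ [] ⊆ ((P ++ A₁) ++ [ x ]) ++ [ a ]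
    xa⊆ = pair (∈-++⁺ʳ (P ++ A₁) (here refl)) (here refl)

    deadQ : DeadSites ((P ++ A) ++ [ q ]) Q [] ⊎ (∀ {z} → z ∈ Q → a < z) →
            DeadSites (((((P ++ A₁) ++ [ x ]) ++ [ a ]) ++ A₂) ++ [ q ]) Q []
    deadQ (inj₁ dead)  = dead-⊆ (⊆.++⁺ prefix⊆ ⊆-refl) ⊆-refl dead
      where
      prefix⊆ : P ++ A₁ ++ a ∷ A₂ ⊆ (((P ++ A₁) ++ [ x ]) ++ [ a ]) ++ A₂
      prefix⊆ = ⊆-trans (⊆-reflexive (trans (sym (++-assoc P A₁ _)) (sym (++-assoc (P ++ A₁) [ a ] A₂))))
        (⊆.++⁺ (⊆.++⁺ (⊆.++⁺ʳ [ x ] (⊆-refl {x = P ++ A₁})) (⊆-refl {x = [ a ]})) ⊆-refl)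
    deadQ (inj₂ large) = dead-ascent x<a (⊆.++⁺ʳ [ q ] (⊆.++⁺ʳ A₂ xa⊆))
      (λ { {s₁} {s} refl → s , here refl , large (∈-++⁺ʳ s₁ (here refl)) })

    sites′ : ∀ {u v} → [ x ] ≡ u ++ v → Active ((P ++ A₁) ++ u) (v ++ a ∷ A₂ ++ q ∷ Q)
    sites′ {[]} refl = subst (λ u → Active u _) (sym (++-identityʳ (P ++ A₁)))
      (active-before [] (above-site refl) decreasing-[] (λ ()) (sites refl))
    sites′ {_ ∷ []} {[]} refl = active-after {u = P ++ A₁} []
        (subst (λ u → Above x (u ++ a ∷ A₂ ++ q ∷ Q)) (sym (++-identityʳ (P ++ A₁))) (above-site refl))
        (λ ())
        (subst (λ u → Active u _) (sym (++-identityʳ (P ++ A₁))) (sites refl))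

module _ {m P A b B} (W : TwoBlocks (suc m) P A b B) where
  open TwoBlocks W
  open Block block

  private
    x = suc m

  -- The ascents from `x` to letters of the second block are harmless, as all letters after them are
  -- smaller.
  twoBlocks-between : TwoBlocks m P (A ++ [ x ]) b B
  twoBlocks-between = record
    { block       = insert-between block
    ; decreasingᴮ = decreasingᴮ
    ; sitesᴮ      = λ { {u} {v} refl → subst (λ t → Active t v)
        (trans (sym (++-assoc (P ++ A) [ x ] (b ∷ u))) (cong (_++ b ∷ u) (++-assoc P A [ x ])))
        (active-after {u = P ++ A} (b ∷ u)
          (subst (Above x) (trans (sym (++-assoc P A _)) (sym (++-assoc (P ++ A) (b ∷ u) v))) above)
          (¬-decreasing-ascent {u = b ∷ u} decreasingᴮ)
          (sitesᴮ refl)) }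
    }

  -- For `t` in `b ∷ B₁` the letters `t x y` form a 312. With `t = b` this kills the places before
  -- letters of `A` too, so that `x` and `y ∷ B₂` become the two blocks.
  twoBlocks-inside : ∀ {B₁ y B₂} → B ≡ B₁ ++ y ∷ B₂ →
                     TwoBlocks m (((P ++ A) ++ [ b ]) ++ B₁) [ x ] y B₂
  twoBlocks-inside {B₁} {y} {B₂} refl = record
    { block = record
      { avoiding   = avoiding-insert above′ active′ (subst (λ u → Avoiding u) eq avoiding)
      ; above      = above-insert P′ above′
      ; decreasing = decreasing-[-]
      ; A<Q        = λ { (here refl) z∈ → above′ (∈-++⁺ʳ P′ z∈) }
      ; deadᴾ      = subst (λ u → DeadSites [] u (x ∷ y ∷ B₂)) (sym P′≡)
          (dead-++ {w = A ++ b ∷ B₁} P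
            (dead-⊆ ⊆-refl (⊆-trans (⊆-reflexive (sym (++-assoc A (b ∷ B₁) (y ∷ B₂))))
                                    (⊆.++⁺ (⊆-refl {x = A ++ b ∷ B₁}) (x ∷ʳ ⊆-refl))) deadᴾ)
            (dead-++ {w = b ∷ B₁} A
              (dead-unlayered λ { {_} {_} {s₂} refl l → l ([312] x<y y<b)
                (_ ∷ʳ ⊆.++⁺ˡ s₂ (refl ∷ ⊆.++⁺ˡ B₁ (refl ∷ refl ∷ minimum _))) })
              (dead-unlayered λ { {s₁} {t} {s₂} eq l → l ([312] x<y (y<t eq))
                (refl ∷ ⊆.++⁺ˡ s₂ (refl ∷ refl ∷ minimum _)) })))
      ; sites      = sites′
      }
    ; decreasingᴮ = decreasing-⊆ (b ∷ʳ ⊆.++⁺ˡ B₁ ⊆-refl) decreasingᴮ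
    ; sitesᴮ      = λ { {u} {v} refl → subst (λ t → Active t v) (sym (++-assoc P′ [ x ] (y ∷ u)))
        (active-after {u = P′} (y ∷ u)
          (subst (Above x) (sym (++-assoc P′ (y ∷ u) v)) above′)
          (¬-decreasing-ascent {u = y ∷ u} (decreasing-⊆ (b ∷ʳ ⊆.++⁺ˡ B₁ ⊆-refl) decreasingᴮ))
          (subst (λ t → Active t v) (P′++ (y ∷ u)) (sitesᴮ (sym (++-assoc B₁ (y ∷ u) v))))) }
    }
    where
    P′ = ((P ++ A) ++ [ b ]) ++ B₁

    P′++ : ∀ u → (P ++ A) ++ b ∷ B₁ ++ u ≡ P′ ++ u
    P′++ u = trans (sym (++-assoc (P ++ A) [ b ] (B₁ ++ u))) (sym (++-assoc ((P ++ A) ++ [ b ]) B₁ u))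

    P′≡ : P′ ≡ P ++ A ++ b ∷ B₁
    P′≡ = trans (++-assoc (P ++ A) [ b ] B₁) (++-assoc P A (b ∷ B₁))

    eq : P ++ A ++ b ∷ B₁ ++ y ∷ B₂ ≡ P′ ++ y ∷ B₂
    eq = trans (sym (++-assoc P A _)) (P′++ (y ∷ B₂))

    above′ : Above x (P′ ++ y ∷ B₂)
    above′ = subst (Above x) eq above

    active′ : Active P′ (y ∷ B₂)
    active′ = subst (λ u → Active u (y ∷ B₂)) (sym (++-assoc (P ++ A) [ b ] B₁)) (sitesᴮ refl)

    x<y : x < y
    x<y = above′ (∈-++⁺ʳ P′ (here refl))

    y<b : y < b
    y<b = decreasingᴮ (refl ∷ from∈ (∈-++⁺ʳ B₁ (here refl)))

    y<t : ∀ {s₁ t s₂} → b ∷ B₁ ≡ s₁ ++ t ∷ s₂ → y < t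
    y<t {s₁} eq = decreasingᴮ (pair {u = b ∷ B₁} (subst (_ ∈_) (sym eq) (∈-++⁺ʳ s₁ (here refl))) (here refl))

    sites′ : ∀ {u v} → [ x ] ≡ u ++ v → Active (P′ ++ u) (v ++ y ∷ B₂)
    sites′ {[]} refl = subst (λ u → Active u _) (sym (++-identityʳ P′))
      (active-before [] above′ decreasing-[] (λ ()) active′)
    sites′ {_ ∷ []} {[]} refl = active-after {u = P′} []
        (subst (λ u → Above x (u ++ y ∷ B₂)) (sym (++-identityʳ P′)) above′)
        (λ ())
        (subst (λ u → Active u _) (sym (++-identityʳ P′)) active′)

  -- For `t` in `A` the letters `t b x` form a 231, which kills the place before `t`. The place
  -- before `b` survives, and `x` prolongs the second block.
  twoBlocks-last : TwoBlocks m (P ++ A) [] b (B ++ [ x ])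
  twoBlocks-last = record
    { block = record
      { avoiding   = subst (λ u → Avoiding u) eq
          (avoiding-insert above′ last-active (subst (λ u → Avoiding u) (sym (++-identityʳ _)) avoiding))
      ; above      = subst (Above m) eq (above-insert (P ++ A ++ b ∷ B) above′)
      ; decreasing = decreasing-[]
      ; A<Q        = λ ()
      ; deadᴾ      = dead-++ {w = A} P
          (dead-⊆ ⊆-refl (⊆.++⁺ (⊆-refl {x = A}) (refl ∷ ⊆.++⁺ʳ [ x ] ⊆-refl)) deadᴾ)
          (dead-unlayered λ { {s₁} {t} {s₂} refl l →
            l ([231] (above (∈-++⁺ʳ P (∈-++⁺ˡ (∈-++⁺ʳ s₁ (here refl))))) (A<Q (∈-++⁺ʳ s₁ (here refl)) (here refl)))
              (refl ∷ ⊆.++⁺ˡ s₂ (refl ∷ ⊆.++⁺ˡ B ⊆-refl)) })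
      ; sites      = λ { {[]} {[]} refl → subst (λ u → Active u (b ∷ B ++ [ x ])) (sym (++-identityʳ (P ++ A)))
          (active-before (b ∷ B) (subst (Above x) word≡ above) decreasingᴮ (λ _ ())
            (subst (Active (P ++ A)) (sym (++-identityʳ (b ∷ B))) (sites (sym (++-identityʳ A))))) }
      }
    ; decreasingᴮ = decreasing-∷ʳ (above ∘ ∈-++⁺ʳ P ∘ ∈-++⁺ʳ A) decreasingᴮ
    ; sitesᴮ      = sitesᴮ′
    }
    where
    word≡ : P ++ A ++ b ∷ B ≡ (P ++ A) ++ b ∷ B ++ []
    word≡ = trans (sym (++-assoc P A (b ∷ B))) (cong ((P ++ A) ++_) (sym (++-identityʳ (b ∷ B))))

    sitesᴮ′ : ∀ {u v} → B ++ [ x ] ≡ u ++ v → Active (((P ++ A) ++ []) ++ b ∷ u) v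
    sitesᴮ′ {u} eq with ++-split {u} B (sym eq)
    ... | inj₁ (r , refl , refl) = subst (λ t → Active (t ++ b ∷ u) (r ++ [ x ])) (sym (++-identityʳ (P ++ A)))
      (active-before r
        (subst (Above x) (trans word≡ (trans (cong (λ t → (P ++ A) ++ b ∷ t) (++-assoc u r []))
                                             (sym (++-assoc (P ++ A) (b ∷ u) (r ++ []))))) above)
        (decreasing-⊆ (b ∷ʳ ⊆.++⁺ˡ u ⊆-refl) decreasingᴮ)
        (λ _ ())
        (sitesᴮ (cong (u ++_) (sym (++-identityʳ r)))))
    ... | inj₂ (_ , [] , refl , refl) = last-active

    above′ : Above x ((P ++ A ++ b ∷ B) ++ [])
    above′ = subst (Above x) (sym (++-identityʳ _)) above

    eq : (P ++ A ++ b ∷ B) ++ [ x ] ≡ (P ++ A) ++ b ∷ B ++ [ x ]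
    eq = trans (cong (_++ [ x ]) (sym (++-assoc P A (b ∷ B)))) (++-assoc (P ++ A) (b ∷ B) [ x ])

module _ {m P A q Q} (W : BlockAscent (suc m) P A q Q) where
  open BlockAscent W
  open Block block

  private
    x = suc m

  blockAscent-between : BlockAscent m P (A ++ [ x ]) q Q
  blockAscent-between = record
    { block  = insert-between block
    ; ascent = ascent
    ; deadᴽ  = dead-⊆ (⊆.++⁺ (⊆.++⁺ (⊆-refl {x = P}) (⊆.++⁺ʳ [ x ] ⊆-refl)) ⊆-refl) ⊆-refl deadᴽ
    }

  -- The place before a letter `t` of `A` dies by the 231 `t q x`, and the place before `q` by the
  -- 231 made of `ascent` and `x`. Only the two sides of `x` remain, hence j = k = 0.
  blockAscent-last : TwoBlocks m (P ++ A ++ q ∷ Q) [] x []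
  blockAscent-last = record
    { block = record
      { avoiding   = avoiding-insert above′ last-active
          (subst (λ u → Avoiding u) (sym (++-identityʳ _)) avoiding)
      ; above      = above-insert (P ++ A ++ q ∷ Q) above′
      ; decreasing = decreasing-[]
      ; A<Q        = λ ()
      ; deadᴾ      = dead-++ P
          (dead-⊆ ⊆-refl (⊆.++⁺ʳ [ x ] ⊆-refl) deadᴾ)
          (dead-++ A
            (dead-unlayered λ { {s₁} {t} {s₂} refl l →
              l ([231] (above (∈-++⁺ʳ P (∈-++⁺ˡ (∈-++⁺ʳ s₁ (here refl))))) (A<Q (∈-++⁺ʳ s₁ (here refl)) (here refl)))
                (refl ∷ ⊆.++⁺ˡ s₂ (refl ∷ ⊆.++⁺ˡ Q ⊆-refl)) })
            (dead-∷
              (λ a → let y , z , y<z , yz⊆ = ascent in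
                layered a ([231] (above (∈-++⁺ʳ P (∈-++⁺ʳ A (to∈ (⊆-trans (refl ∷ minimum _) yz⊆))))) y<z)
                  (⊆.++⁺ yz⊆ (⊆-refl {x = [ x ]})))
              (dead-⊆ ⊆-refl (minimum _) deadᴽ)))
      ; sites      = λ { {[]} {[]} refl → active-before []
          (subst (λ u → Above x (u ++ [])) (sym (++-identityʳ _)) above′) decreasing-[] (λ ()) last-active }
      }
    ; decreasingᴮ = decreasing-[-]
    ; sitesᴮ      = λ { {[]} {[]} refl → last-active }
    }
    where
    above′ : Above x ((P ++ A ++ q ∷ Q) ++ [])
    above′ = subst (Above x) (sym (++-identityʳ _)) above

-- The nodes satisfy the recurrences

sumBelow-const : ∀ c n → sumBelow (λ _ → c) n ≡ n ℕ.* c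
sumBelow-const c zero    = refl
sumBelow-const c (suc n) = cong (c ℕ.+_) (sumBelow-const c n)

-- The step shared by both kinds of node: `P` contributes nothing, each letter of `A` one
-- BlockAscent child with parameter 1, and the places from the one before `q` onwards are left to
-- the last hypothesis.
size-block : ∀ {m P A q Q n} (B : Block (suc m) P A q Q) →
  (∀ {A₁ a A₂} → A ≡ A₁ ++ a ∷ A₂ →
    Descendant m ((P ++ A₁) ++ suc m ∷ a ∷ A₂ ++ q ∷ Q) HasSize ascentCount m 1) →
  Inserted m (P ++ A) (q ∷ Q) HasSize n →
  Descendant (suc m) (P ++ A ++ q ∷ Q) HasSize (length A ℕ.* ascentCount m 1 ℕ.+ n)
size-block {m} {P} {A} {q} {Q} {n} B sizes rest = size-descendant-suc above
  (size-inserted-dead [] P (A ++ q ∷ Q) above deadᴾ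
    (subst (λ k → Inserted m P (A ++ q ∷ Q) HasSize (k ℕ.+ n)) (sumBelow-const _ (length A))
      (size-inserted-++ (λ _ → ascentCount m 1) P A (q ∷ Q) (above ∘ ∈-++⁺ʳ P ∘ ∈-++⁺ˡ) sizes rest)))
  where open Block B

between-word : ∀ (P A : Word) {x R} → P ++ (A ++ [ x ]) ++ R ≡ (P ++ A) ++ x ∷ R
between-word P A {x} {R} = trans (cong (P ++_) (++-assoc A [ x ] R)) (sym (++-assoc P A (x ∷ R)))

length-∷ʳ : ∀ (w : Word) {x} → length (w ++ [ x ]) ≡ suc (length w)
length-∷ʳ w = trans (length-++ w) (ℕₚ.+-comm (length w) 1)

mutual
  -- `insert-before`, `twoBlocks-between`, `twoBlocks-inside` and `twoBlocks-last` supply the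
  -- summands of `twoBlockCount` in this order.
  size-twoBlocks : ∀ m {P A b B} → TwoBlocks m P A b B →
    Descendant m (P ++ A ++ b ∷ B) HasSize twoBlockCount m (length A) (length B)
  size-twoBlocks zero    W = size-descendant-zero above avoiding
    where open Block (TwoBlocks.block W)
  size-twoBlocks (suc m) {P} {A} {b} {B} W = size-block block
    (λ { refl → size-blockAscent m (insert-before block refl
      (inj₂ (λ z∈ → A<Q (∈-++⁺ʳ _ (here refl)) (there z∈)))) })
    (size-inserted-∷ (above (∈-++⁺ʳ P (∈-++⁺ʳ A (here refl))))
      (subst₂ (λ w k → Descendant m w HasSize k) (between-word P A)
        (cong (λ j → twoBlockCount m j (length B)) (length-∷ʳ A))
        (size-twoBlocks m (twoBlocks-between W)))
      (subst (λ u → Inserted m ((P ++ A) ++ [ b ]) u HasSize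
                (sumBelow (twoBlockCount m 1) (length B) ℕ.+ twoBlockCount m 0 (suc (length B)))) (++-identityʳ B)
        (size-inserted-++ (twoBlockCount m 1) ((P ++ A) ++ [ b ]) B [] (above ∘ ∈-++⁺ʳ P ∘ ∈-++⁺ʳ A ∘ there)
          (λ { {v₂ = v₂} refl →
            subst (λ u → Descendant m (_ ++ suc m ∷ _ ∷ u) HasSize twoBlockCount m 1 (length v₂))
            (sym (++-identityʳ v₂)) (size-twoBlocks m (twoBlocks-inside W refl)) })
          (size-inserted-[]
            (subst₂ (λ w k → Descendant m w HasSize k) last-word
              (cong (twoBlockCount m 0) (length-∷ʳ B))
              (size-twoBlocks m (twoBlocks-last W)))))))
    where
    open TwoBlocks W
    open Block block

    last-word : (P ++ A) ++ b ∷ B ++ [ suc m ] ≡ (((P ++ A) ++ [ b ]) ++ B) ++ [ suc m ]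
    last-word = trans (sym (++-assoc (P ++ A) (b ∷ B) [ suc m ]))
      (cong (_++ [ suc m ]) (sym (++-assoc (P ++ A) [ b ] B)))

  -- The summands come from `insert-before`, `blockAscent-between` and `blockAscent-last`; the
  -- places inside `q ∷ Q` give none.
  size-blockAscent : ∀ m {P A q Q} → BlockAscent m P A q Q →
    Descendant m (P ++ A ++ q ∷ Q) HasSize ascentCount m (length A)
  size-blockAscent zero    W = size-descendant-zero above avoiding
    where open Block (BlockAscent.block W)
  size-blockAscent (suc m) {P} {A} {q} {Q} W = size-block block
    (λ eq → size-blockAscent m (insert-before block eq (inj₁ deadᴽ)))
    (size-inserted-∷ (above (∈-++⁺ʳ P (∈-++⁺ʳ A (here refl))))
      (subst₂ (λ w k → Descendant m w HasSize k) (between-word P A)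
        (cong (ascentCount m) (length-∷ʳ A))
        (size-blockAscent m (blockAscent-between W)))
      (subst (λ u → Inserted m ((P ++ A) ++ [ q ]) u HasSize _) (++-identityʳ Q)
        (size-inserted-dead ((P ++ A) ++ [ q ]) Q []
          (subst (Above (suc m)) dead-word above)
          deadᴽ
          (size-inserted-[]
            (subst (λ w → Descendant m (w ++ [ suc m ]) HasSize twoBlockCount m 0 0) last-word
              (size-twoBlocks m (blockAscent-last W)))))))
    where
    open BlockAscent W
    open Block block

    last-word : P ++ A ++ q ∷ Q ≡ ((P ++ A) ++ [ q ]) ++ Q
    last-word = trans (sym (++-assoc P A (q ∷ Q))) (sym (++-assoc (P ++ A) [ q ] Q))

    dead-word : P ++ A ++ q ∷ Q ≡ ((P ++ A) ++ [ q ]) ++ Q ++ []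
    dead-word = trans last-word (cong (((P ++ A) ++ [ q ]) ++_) (sym (++-identityʳ Q)))

singleton-twoBlocks : ∀ m → TwoBlocks m [] [] (suc m) []
singleton-twoBlocks m = record
  { block = record
    { avoiding   = λ { _ (_ ∷ʳ ()) ; _ (refl ∷ ()) }
    ; above      = λ { (here refl) → ℕₚ.≤-refl }
    ; decreasing = decreasing-[]
    ; A<Q        = λ ()
    ; deadᴾ      = λ { {[]} () ; {_ ∷ _} () }
    ; sites      = λ { {[]} {[]} refl → active (λ { _ (_ ∷ʳ ()) ; _ (refl ∷ ()) }) (λ _ _ ()) }
    }
  ; decreasingᴮ = decreasing-[-]
  ; sitesᴮ      = λ { {[]} {[]} refl → last-active }
  }

-- The only place in the empty word yields the one-letter word, the node j = k = 0.
size-descendant-[] : ∀ n → Descendant n [] HasSize avoiderCount n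
size-descendant-[] zero    = size-descendant-zero (λ ()) (λ _ ())
size-descendant-[] (suc m) = subst (Descendant (suc m) [] HasSize_) (twoBlockCount≡avoiderCount m)
  (size-descendant-suc (λ ()) (size-inserted-[] (size-twoBlocks m (singleton-twoBlocks m))))

-- Order isomorphism and the three patterns

T₃₁ : List Word
T₃₁ = (1 ∷ 3 ∷ 4 ∷ 2 ∷ []) ∷ (1 ∷ 4 ∷ 2 ∷ 3 ∷ []) ∷ (2 ∷ 3 ∷ 1 ∷ 4 ∷ []) ∷ []

-- The letters of `τ` are distinct, so trichotomy turns strict monotonicity into an equivalence. For
-- a concrete `τ` the Boolean comparisons compute, so that false ones are refuted by absurd patterns
-- and injectivity is decided by evaluation.
strictlyMonotone⇒orderIsomorphic : ∀ {σ τ} (len : length σ ≡ length τ)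
  {inj : True (allFin? λ i → allFin? λ j → (lookup τ i ℕₚ.≟ lookup τ j) →-dec (i ≟ᶠ j))} →
  (∀ i j → T (lookup τ (cast len i) <ᵇ lookup τ (cast len j)) → lookup σ i < lookup σ j) →
  OrderIsomorphic σ τ
strictlyMonotone⇒orderIsomorphic {σ} {τ} len {inj} mono = mkOrderIso len λ i j → mk⇔
  (reflects i j)
  (λ lt → mono i j (ℕₚ.<⇒<ᵇ lt))
  where
  reflects : ∀ i j → lookup σ i < lookup σ j → lookup τ (cast len i) < lookup τ (cast len j)
  reflects i j σi<σj with ℕₚ.<-cmp (lookup τ (cast len i)) (lookup τ (cast len j))
  ... | tri< lt _ _ = lt
  ... | tri> _ _ gt = contradiction (mono j i (ℕₚ.<⇒<ᵇ gt)) (ℕₚ.<-asym σi<σj)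
  ... | tri≈ _ eq _ = contradiction σi<σj (ℕₚ.<-irrefl (cong (lookup σ) i≡j))
    where
    i≡j : i ≡ j
    i≡j = toℕ-injective (trans (sym (toℕ-cast len i))
      (trans (cong toℕ (toWitness inj _ _ eq)) (toℕ-cast len j)))

forbidden⇒¬avoids : ∀ {a b c d π} → Forbidden a b c d → a ∷ b ∷ c ∷ d ∷ [] ⊆ π → ¬ All (π Avoids_) T₃₁
forbidden⇒¬avoids ([1342] a<d d<b b<c) σ⊆ (avoids ∷ _) =
  avoids (_ , σ⊆ , strictlyMonotone⇒orderIsomorphic refl λ where
    0F 1F _ → ℕₚ.<-trans a<d d<b
    0F 2F _ → ℕₚ.<-trans a<d (ℕₚ.<-trans d<b b<c)
    0F 3F _ → a<d
    1F 2F _ → b<c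
    3F 1F _ → d<b
    3F 2F _ → ℕₚ.<-trans d<b b<c
    1F 3F ()
    2F 0F ()
    3F 0F ()
    2F 3F ()
    3F 3F ())
forbidden⇒¬avoids ([1423] a<c c<d d<b) σ⊆ (_ ∷ avoids ∷ _) =
  avoids (_ , σ⊆ , strictlyMonotone⇒orderIsomorphic refl λ where
    0F 1F _ → ℕₚ.<-trans a<c (ℕₚ.<-trans c<d d<b)
    0F 2F _ → a<c
    0F 3F _ → ℕₚ.<-trans a<c c<d
    2F 1F _ → ℕₚ.<-trans c<d d<b
    2F 3F _ → c<d
    3F 1F _ → d<b
    1F 0F ()
    1F 3F ()
    2F 0F ()
    3F 0F ()
    1F 2F ()
    2F 2F ()
    3F 2F ()
    3F 3F ())
forbidden⇒¬avoids ([2314] c<a a<b b<d) σ⊆ (_ ∷ _ ∷ avoids ∷ _) =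
  avoids (_ , σ⊆ , strictlyMonotone⇒orderIsomorphic refl λ where
    0F 1F _ → a<b
    0F 3F _ → ℕₚ.<-trans a<b b<d
    1F 3F _ → b<d
    2F 0F _ → c<a
    2F 1F _ → ℕₚ.<-trans c<a a<b
    2F 3F _ → ℕₚ.<-trans c<a (ℕₚ.<-trans a<b b<d)
    3F 0F ()
    3F 1F ()
    2F 2F ()
    3F 2F ()
    3F 3F ())

-- Comparing the letters that hold consecutive values of a pattern gives the chain of inequalities
-- in `Forbidden`.
avoiding⇒avoids : ∀ {π} → Avoiding π → All (π Avoids_) T₃₁
avoiding⇒avoids {π} avoiding = avoids₁ ∷ avoids₂ ∷ avoids₃ ∷ []
  where
  open Equivalence

  avoids₁ : π Avoids (1 ∷ 3 ∷ 4 ∷ 2 ∷ [])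
  avoids₁ (_ ∷ _ ∷ _ ∷ _ ∷ [] , σ⊆ , mkOrderIso _ iso) = avoiding
    ([1342] (from (iso 0F 3F) (ℕₚ.<ᵇ⇒< 1 2 _))
            (from (iso 3F 1F) (ℕₚ.<ᵇ⇒< 2 3 _))
            (from (iso 1F 2F) (ℕₚ.<ᵇ⇒< 3 4 _))) σ⊆

  avoids₂ : π Avoids (1 ∷ 4 ∷ 2 ∷ 3 ∷ [])
  avoids₂ (_ ∷ _ ∷ _ ∷ _ ∷ [] , σ⊆ , mkOrderIso _ iso) = avoiding
    ([1423] (from (iso 0F 2F) (ℕₚ.<ᵇ⇒< 1 2 _))
            (from (iso 2F 3F) (ℕₚ.<ᵇ⇒< 2 3 _))
            (from (iso 3F 1F) (ℕₚ.<ᵇ⇒< 3 4 _))) σ⊆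

  avoids₃ : π Avoids (2 ∷ 3 ∷ 1 ∷ 4 ∷ [])
  avoids₃ (_ ∷ _ ∷ _ ∷ _ ∷ [] , σ⊆ , mkOrderIso _ iso) = avoiding
    ([2314] (from (iso 2F 0F) (ℕₚ.<ᵇ⇒< 1 2 _))
            (from (iso 0F 1F) (ℕₚ.<ᵇ⇒< 2 3 _))
            (from (iso 1F 3F) (ℕₚ.<ᵇ⇒< 3 4 _))) σ⊆

descendant-[]⇔S : ∀ {n π} → Descendant n [] π ⇔ S n T₃₁ π
descendant-[]⇔S {n} = mk⇔
  (λ d → ↭-trans (perm d) (↭-reflexive (++-identityʳ _)) , avoiding⇒avoids (avoids d))
  (λ (π↭ , avoids) → descendant
    (filter-none _ (All-resp-↭ (↭-sym π↭) (All.applyUpTo⁺₁ suc n ℕₚ.≤⇒≯)))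
    (↭-trans π↭ (↭-reflexive (sym (++-identityʳ _))))
    (λ f σ⊆ → forbidden⇒¬avoids f σ⊆ avoids))

∣S∣≡avoiderCount : ∀ n → ∣S∣ n T₃₁ ≡ avoiderCount n
∣S∣≡avoiderCount n = trans
  (card-unique (S-enumeration n T₃₁) (_HasSize_.enumeration sized))
  (_HasSize_.size sized)
  where
  sized : S n T₃₁ HasSize avoiderCount n
  sized = size-⇔ descendant-[]⇔S (size-descendant-[] n)

theorem31 : let T : List Word
                T = (1 ∷ 3 ∷ 4 ∷ 2 ∷ []) ∷ (1 ∷ 4 ∷ 2 ∷ 3 ∷ []) ∷ (2 ∷ 3 ∷ 1 ∷ 4 ∷ []) ∷ [] in
            F T ≗ (const (+ 1) - const (+ 3) * X + X ^ 2) / (const (+ 1) - X) * catalan ^ 3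
theorem31 n = begin
  + ∣S∣ n T₃₁                               ≡⟨ cong +_ (∣S∣≡avoiderCount n) ⟩
  + avoiderCount n                         ≡⟨ quotient*ballotSeries n ⟨
  (quotient * ballotSeries 3) n            ≡⟨ *-cong numerator/[1-X] catalan^3≗ballotSeries n ⟨
  (numerator / (const (+ 1) - X) * catalan ^ 3) n ∎
  where open ≡-Reasoning
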